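{- If $G$ is a connected cograph of order $n\geq 7$, then $$M_{G}\leq \frac{n+1}{2}-\frac{(n-1)^{2}}{2(2^{n-1}+n-1)},$$ with equality if and only if $G\cong K_{1,n-1}$. Generally, if $G$ is a connected cograph of order $n\geq 1$, then $M_G\leq \tfrac{n+1}{2}$, with equality if and only if $n=1$.
   Context: All graphs are finite and simple with at least one vertex; the order of a graph is its number of vertices. A graph is a cograph if it contains no induced path on $4$ vertices. For a graph $G$ of order $n$, let $a_k(G)$ be the number of $k$-element vertex subsets of $G$ that induce a connected subgraph (single vertices count as connected), and let $\Phi_G(x)=\sum_{k=1}^n a_k(G)x^k$. The global mean of $G$ is $M_G=\Phi_G'(1)/\Phi_G(1)$, i.e. the average order of the connected induced subgraphs of $G$. $K_{s,t}$ denotes the complete bipartite graph with parts of sizes $s$ and $t$. -}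

module Defs where

open import Data.Nat.Base using (ℕ; zero; suc; _+_; _*_; _∸_; _^_; NonZero; >-nonZero; _<_)
import Data.Nat.Properties as ℕ
open import Data.Integer.Base using (+_)
open import Data.Rational.Base using (ℚ; _/_)
open import Data.Fin.Base using (Fin; zero; suc; toℕ)
open import Data.Fin.Properties using (all?; any?)
open import Data.Fin.Subset using (Subset; inside; outside; _∈_; ∣_∣; ⁅_⁆; _∪_; _⊃_)
open import Data.Fin.Subset.Properties
  using (_∈?_; nonempty?; x∈⁅x⁆; x∈⁅y⁆⇒x≡y; ∣⁅x⁆∣≡1; x∈p∪q⁻; x∈p∪q⁺; p⊆p∪q)
open import Data.Fin.Subset.Induction using (⊃-wellFounded; Acc; acc)
open import Data.List.Base using (List; []; _∷_; _++_; map; filter; length; zipWith; applyUpTo)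
open import Data.List.Properties using (filter-some)
open import Data.List.Membership.Propositional using (lose) renaming (_∈_ to _∈ˡ_)
open import Data.List.Membership.Propositional.Properties using (∈-map⁺; ∈-++⁺ˡ; ∈-++⁺ʳ)
open import Data.List.Relation.Unary.Any using (here)
open import Data.Vec.Base using ([]; _∷_)
open import Data.Vec.Properties.WithK using ([]=-irrelevant)
open import Data.Product.Base using (Σ; ∃; _×_; _,_; proj₁; proj₂)
open import Data.Sum.Base using (_⊎_; inj₁; inj₂; swap)
open import Data.Unit.Base using (⊤; tt)
open import Data.Empty using (⊥)
open import Function.Bundles using (_⇔_; _↔_; _↣_; Inverse; Injection)
open import Relation.Binary.Construct.Closure.ReflexiveTransitive using (Star; ε; _◅_; _◅◅_)
open import Relation.Binary.Core using (Rel)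
open import Relation.Binary.Definitions using (Decidable; Irreflexive; Symmetric)
open import Relation.Binary.PropositionalEquality using (_≡_; refl; sym; subst)
open import Relation.Nullary.Decidable using (Dec; yes; no; map′; _×-dec_; _⊎-dec_; ¬?)
open import Relation.Nullary.Negation using (¬_; contradiction)
open import Level using (0ℓ)

-- A graph of order n is a Graph (Fin n).

record Graph (V : Set) : Set₁ where
  field
    Adj        : Rel V 0ℓ
    adj?       : Decidable Adj
    adj-sym    : Symmetric Adj
    adj-irrefl : Irreflexive _≡_ Adj

open Graph public

induced : ∀ {V} → Graph V → (P : V → Set) → Graph (∃ P)
induced G P = record
  { Adj        = λ x y → Adj G (proj₁ x) (proj₁ y)
  ; adj?       = λ x y → adj? G (proj₁ x) (proj₁ y)
  ; adj-sym    = adj-sym G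
  ; adj-irrefl = λ { refl → adj-irrefl G refl }
  }

-- The graph without vertices does not count as connected.

Connected : ∀ {V} → Graph V → Set
Connected {V} G = V × (∀ u v → Star (Adj G) u v)

infix 4 _≅_ _↪_

_≅_ : ∀ {V W} → Graph V → Graph W → Set
_≅_ {V} {W} G H =
  Σ (V ↔ W) λ f → ∀ u v → Adj G u v ⇔ Adj H (Inverse.to f u) (Inverse.to f v)

-- H ↪ G: G has an induced subgraph isomorphic to H.

_↪_ : ∀ {V W} → Graph V → Graph W → Set
_↪_ {V} {W} H G =
  Σ (V ↣ W) λ f → ∀ u v → Adj H u v ⇔ Adj G (Injection.to f u) (Injection.to f v)

path : ∀ n → Graph (Fin n)
path n = record
  { Adj        = λ i j → toℕ j ≡ suc (toℕ i) ⊎ toℕ i ≡ suc (toℕ j)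
  ; adj?       = λ i j → (toℕ j ℕ.≟ suc (toℕ i)) ⊎-dec (toℕ i ℕ.≟ suc (toℕ j))
  ; adj-sym    = swap
  ; adj-irrefl = λ { refl (inj₁ p) → ℕ.1+n≢n (sym p) ; refl (inj₂ p) → ℕ.1+n≢n (sym p) }
  }

Cograph : ∀ {V} → Graph V → Set
Cograph G = ¬ (path 4 ↪ G)

K : ∀ s t → Graph (Fin s ⊎ Fin t)
K s t = record { Adj = A ; adj? = A? ; adj-sym = λ {x} {y} → A-sym x y ; adj-irrefl = A-irr }
  where
  A : Rel (Fin s ⊎ Fin t) 0ℓ
  A (inj₁ _) (inj₁ _) = ⊥
  A (inj₁ _) (inj₂ _) = ⊤
  A (inj₂ _) (inj₁ _) = ⊤
  A (inj₂ _) (inj₂ _) = ⊥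

  A? : Decidable A
  A? (inj₁ _) (inj₁ _) = no λ ()
  A? (inj₁ _) (inj₂ _) = yes tt
  A? (inj₂ _) (inj₁ _) = yes tt
  A? (inj₂ _) (inj₂ _) = no λ ()

  A-sym : ∀ x y → A x y → A y x
  A-sym (inj₁ _) (inj₂ _) _ = tt
  A-sym (inj₂ _) (inj₁ _) _ = tt

  A-irr : Irreflexive _≡_ A
  A-irr {inj₁ _} refl ()
  A-irr {inj₂ _} refl ()

module _ {n} (G : Graph (Fin n)) (S : Subset n) where

  private
    GS : Graph (∃ (_∈ S))
    GS = induced G (_∈ S)

    all∈? : {Q : ∃ (_∈ S) → Set} → (∀ x → Dec (Q x)) → Dec (∀ x → Q x)
    all∈? {Q} Q? = map′ (λ h x → h (proj₁ x) (proj₂ x)) (λ h v p → h (v , p)) (all? dec)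
      where
      dec : ∀ v → Dec (∀ p → Q (v , p))
      dec v with v ∈? S
      ... | no v∉S = yes λ v∈S → contradiction v∈S v∉S
      ... | yes p  = map′ (λ q p′ → subst (λ r → Q (v , r)) ([]=-irrelevant p p′) q)
                          (λ h → h p) (Q? (v , p))

    -- The set T of vertices known to be reachable from u is enlarged until
    -- no edge of the induced subgraph leaves it.
    grow : ∀ u (T : Subset n) → Acc _⊃_ T → proj₁ u ∈ T →
           (∀ x → x ∈ T → Σ (x ∈ S) λ p → Star (Adj GS) u (x , p)) →
           ∀ v → Dec (Star (Adj GS) u v)
    grow u T (acc rec) u∈T inv v
      with any? (λ x → any? (λ y →
             (x ∈? T) ×-dec ((y ∈? S) ×-dec (¬? (y ∈? T) ×-dec adj? G x y))))
    ... | yes (x , y , x∈T , y∈S , y∉T , xy) =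
      grow u (T ∪ ⁅ y ⁆)
           (rec (p⊆p∪q ⁅ y ⁆ , y , x∈p∪q⁺ (inj₂ (x∈⁅x⁆ y)) , y∉T))
           (p⊆p∪q ⁅ y ⁆ u∈T) inv′ v
      where
      inv′ : ∀ z → z ∈ T ∪ ⁅ y ⁆ → Σ (z ∈ S) λ p → Star (Adj GS) u (z , p)
      inv′ z z∈ with x∈p∪q⁻ T ⁅ y ⁆ z∈
      ... | inj₁ z∈T = inv z z∈T
      ... | inj₂ z∈y with refl ← x∈⁅y⁆⇒x≡y y z∈y =
        y∈S , (proj₂ (inv x x∈T) ◅◅ (xy ◅ ε))
    ... | no closed = map′ found (stays u∈T) (proj₁ v ∈? T)
      where
      found : proj₁ v ∈ T → Star (Adj GS) u v
      found v∈T = subst (λ p → Star (Adj GS) u (proj₁ v , p)) ([]=-irrelevant _ _)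
                        (proj₂ (inv (proj₁ v) v∈T))

      stays : ∀ {x y} → proj₁ x ∈ T → Star (Adj GS) x y → proj₁ y ∈ T
      stays x∈T ε = x∈T
      stays {x} x∈T (_◅_ {j = z} xz zy) with proj₁ z ∈? T
      ... | yes z∈T = stays z∈T zy
      ... | no  z∉T = contradiction (proj₁ x , proj₁ z , x∈T , proj₂ z , z∉T , xz) closed

    reach? : ∀ u v → Dec (Star (Adj GS) u v)
    reach? u = grow u ⁅ proj₁ u ⁆ (⊃-wellFounded _) (x∈⁅x⁆ _) start
      where
      start : ∀ x → x ∈ ⁅ proj₁ u ⁆ → Σ (x ∈ S) λ p → Star (Adj GS) u (x , p)
      start x x∈ with refl ← x∈⁅y⁆⇒x≡y (proj₁ u) x∈ = proj₂ u , ε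

  connected? : Dec (Connected (induced G (_∈ S)))
  connected? = nonempty? S ×-dec all∈? (λ u → all∈? (reach? u))

-- Coefficient lists, constant term first.

Poly : Set
Poly = List ℕ

eval : Poly → ℕ → ℕ
eval []       x = 0
eval (c ∷ cs) x = c + x * eval cs x

deriv : Poly → Poly
deriv []       = []
deriv (_ ∷ cs) = zipWith _*_ (applyUpTo suc (length cs)) cs

subsets : ∀ n → List (Subset n)
subsets zero    = [] ∷ []
subsets (suc n) = map (inside ∷_) (subsets n) ++ map (outside ∷_) (subsets n)

subsets-complete : ∀ {m} (S : Subset m) → S ∈ˡ subsets m
subsets-complete []            = here refl
subsets-complete (inside  ∷ S) = ∈-++⁺ˡ (∈-map⁺ _ (subsets-complete S))
subsets-complete (outside ∷ S) = ∈-++⁺ʳ _ (∈-map⁺ _ (subsets-complete S))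

module _ {n} (G : Graph (Fin n)) where

  counted? : ∀ k S → Dec (∣ S ∣ ≡ k × Connected (induced G (_∈ S)))
  counted? k S = (∣ S ∣ ℕ.≟ k) ×-dec connected? G S

  a : ℕ → ℕ
  a k = length (filter (counted? k) (subsets n))

  Φ : Poly
  Φ = 0 ∷ applyUpTo (λ i → a (suc i)) n

  singleton-connected : ∀ v → Connected (induced G (_∈ ⁅ v ⁆))
  singleton-connected v = (v , x∈⁅x⁆ v) , walk
    where
    walk : ∀ x y → Star (Adj (induced G (_∈ ⁅ v ⁆))) x y
    walk (x , p) (y , q)
      with refl ← x∈⁅y⁆⇒x≡y v p | refl ← x∈⁅y⁆⇒x≡y v q
      with refl ← []=-irrelevant p q = ε

  a₁>0 : Fin n → 0 < a 1
  a₁>0 v = filter-some (counted? 1)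
    (lose (subsets-complete ⁅ v ⁆) (∣⁅x⁆∣≡1 v , singleton-connected v))

eval-Φ≢0 : ∀ {n} .{{_ : NonZero n}} (G : Graph (Fin n)) → NonZero (eval (Φ G) 1)
eval-Φ≢0 {suc n} G = >-nonZero
  (ℕ.≤-trans (a₁>0 G zero)
    (ℕ.≤-trans (ℕ.m≤m+n (a G 1) _) (ℕ.m≤m+n _ 0)))

M : ∀ {n} .{{_ : NonZero n}} → Graph (Fin n) → ℚ
M G = _/_ (+ eval (deriv (Φ G)) 1) (eval (Φ G) 1) {{eval-Φ≢0 G}}

denominator≢0 : ∀ n → NonZero (2 * (2 ^ (n ∸ 1) + (n ∸ 1)))
denominator≢0 n = ℕ.m*n≢0 2 _
  {{_}} {{>-nonZero (ℕ.≤-trans (ℕ.m^n>0 2 (n ∸ 1)) (ℕ.m≤m+n _ (n ∸ 1)))}}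

{-# OPTIONS --safe #-}
module Submission where

-- A connected cograph with at least two vertices is a complete join of two cographs of orders s and t.
-- A vertex set that meets both sides is connected, so the number N of connected sets and the sum T of
-- their sizes obey exact recursions, and D = (n + 1) N - 2 T measures by how much the mean T / N stays
-- below (n + 1) / 2.  Put m = n - 1; the claim is m² N ≤ D κ with κ = 2^m + m.
-- * If a vertex c is adjacent to all others, then D = m² + X and N = κ + e, where e counts the connected
--   sets S of size at least 2 in the cograph G - c, and X is the sum of m + 2 - 2 |S| over these.
--   As 3 m² ≤ 2 κ, it suffices that e = 0 (the star) or 2 e < 3 X.
-- * If s, t ≥ 2, then the sets meeting both sides dominate: they give D ≥ 2 m² and N < 2 κ, except for
--   {s , t} = {2 , 5}, where the numbers are compared directly.
-- The bound D ≥ m², which follows from e < X + n, settles the second part.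

-- The weight `∣ U ∣ + 2 - 2 ∣ S ∣` removes all subtraction from the recursion. Over the nonempty
-- subsets A of an s-set, s + 1 - 2 |A| sums to 2^s - s - 1; a set that meets both parts of a join
-- uses one such term for each part, whence the `+ 2` and the nonnegative coefficients of
-- `mixedExcess`. The weight in D is smaller by one, so D = n m + X - e when e and X are taken over
-- G itself, and bounds on D come down to comparing e with X. Disconnected cographs must be part of
-- the recursion because G - c need not be connected. A factor above 1 between e and X is
-- unavoidable: m² ≤ κ alone would ask for e < X, which fails when G - c is the star `K 1 5`, where
-- e = 31 and X = 26.

open import Defs
open import Data.Nat.Base using (ℕ; zero; suc; _+_; _∸_; _*_; _^_; _<_; z≤n; s≤s; NonZero; >-nonZero)
  renaming (_≤_ to _≤ℕ_)
import Data.Nat.Properties as ℕ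
open import Data.Nat.ListAction using (sum)
open import Data.Nat.ListAction.Properties using (sum-++)
open import Data.Nat.Tactic.RingSolver using (solve-∀)
open import Data.Fin.Base using (Fin; zero; suc; punchIn; punchOut)
open import Data.Fin.Properties
  using (any?; _≟_; punchIn-punchOut; punchOut-punchIn; punchInᵢ≢i; punchOut-cong′)
open import Data.Fin.Subset
  using (Subset; inside; outside; _∈_; _⊆_; _⊂_; _⊃_; _∪_; ⁅_⁆; ⊥; ∣_∣; Nonempty)
import Data.Fin.Subset as Sub
open import Data.Fin.Subset.Properties
open import Data.Fin.Subset.Induction using (⊃-wellFounded; ⊂-wellFounded; Acc; acc)
open import Data.List.Base using (List; []; _∷_; map; filter; length; applyUpTo; zipWith)
open import Data.List.Properties using (map-++; map-∘; map-cong; length-applyUpTo)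
open import Data.Vec.Base using ([]; _∷_; here; there; tabulate)
open import Data.Vec.Properties using (lookup∘tabulate; []=⇒lookup; lookup⇒[]=)
open import Data.Product.Base using (_×_; _,_; proj₁; proj₂; ∃; ∃₂)
open import Data.Sum.Base using (_⊎_; inj₁; inj₂; [_,_]′; swap)
open import Data.Unit.Base using (tt)
import Data.Empty as Empty
open import Function.Base using (_∘_; id)
open import Function.Bundles using (_⇔_; mk⇔; mk↣; mk↔ₛ′; Equivalence; Inverse)
open import Relation.Binary.Construct.Closure.ReflexiveTransitive using (Star; ε; _◅_)
open import Relation.Binary.PropositionalEquality
open import Relation.Nullary.Decidable
  using (Dec; yes; no; does; _×-dec_; _⊎-dec_; ¬?; decidable-stable; dec-true)
open import Relation.Nullary.Negation using (¬_; contradiction)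

-- Arithmetic of complete joins

-- 2^s - s - 1, the number of subsets of an s-set with at least two elements.
big : ℕ → ℕ
big zero    = 0
big (suc s) = 2 * big s + s

2^≡big : ∀ s → 2 ^ s ≡ big s + s + 1
2^≡big zero    = refl
2^≡big (suc s) = trans (cong (2 *_) (2^≡big s)) (doubled (big s) s)
  where
  doubled : ∀ a s → 2 * (a + s + 1) ≡ 2 * a + s + (1 + s) + 1
  doubled = solve-∀

-- (2^s - 1)(2^t - 1), the number of sets S that meet both parts of a join of orders s and t; mixedExcess is
-- the sum of s + t + 2 - 2 |S| over these S.
mixed : ℕ → ℕ → ℕ
mixed s t = (big s + s) * (big t + t)

mixedExcess : ℕ → ℕ → ℕ
mixedExcess s t = 2 * (big s * big t) + s * big t + t * big s

mixed-comm : ∀ s t → mixed s t ≡ mixed t s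
mixed-comm s t = ℕ.*-comm (big s + s) (big t + t)

mixedExcess-comm : ∀ s t → mixedExcess s t ≡ mixedExcess t s
mixedExcess-comm s t = comm (big s) (big t) s t
  where
  comm : ∀ a b s t → 2 * (a * b) + s * b + t * a ≡ 2 * (b * a) + t * a + s * b
  comm = solve-∀

≤big[1+] : ∀ i → i ≤ℕ big (1 + i)
≤big[1+] i = ℕ.m≤n+m i (2 * big i)

private
  ≤-step-+ : ∀ {m n} o → m + o ≡ n → m ≤ℕ n
  ≤-step-+ {m} o refl = ℕ.m≤m+n m o

-- `mixedExcess s t - mixed s t` equals `big s * big t - s * t`, so the claim amounts to
-- `(s - 1) * (t - 1) ≤ big s * big t`, which holds factor by factor.
mixed<mixedExcess+size : ∀ {s t} → 0 < s → 0 < t → mixed s t < mixedExcess s t + (s + t)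
mixed<mixedExcess+size {suc i} {suc j} _ _ = ℕ.+-cancelʳ-≤ (i * j) _ _ (begin
  suc (mixed (suc i) (suc j)) + i * j
    ≤⟨ ℕ.+-monoʳ-≤ _ (ℕ.*-mono-≤ (≤big[1+] i) (≤big[1+] j)) ⟩
  suc (mixed (suc i) (suc j)) + big (suc i) * big (suc j)
    ≡⟨ rearranged (big (suc i)) (big (suc j)) i j ⟩
  mixedExcess (suc i) (suc j) + (suc i + suc j) + i * j ∎)
  where
  open ℕ.≤-Reasoning
  rearranged : ∀ a b i j →
    1 + (a + (1 + i)) * (b + (1 + j)) + a * b
    ≡ 2 * (a * b) + (1 + i) * b + (1 + j) * a + ((1 + i) + (1 + j)) + i * j
  rearranged = solve-∀

-- The threshold 4 is the least possible: `big 3 = 4` is below 6, while `big 4 = 11` exceeds 8.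
big-4+ : ∀ j → 2 * (4 + j) < big (4 + j)
big-4+ zero    = ℕ.m≤m+n 9 2
big-4+ (suc j) = begin-strict
  2 * (5 + j)                 ≡⟨ shifted j ⟩
  2 * (4 + j) + 2             <⟨ ℕ.+-mono-<-≤ (big-4+ j) (ℕ.m≤m+n 2 (2 + j)) ⟩
  big (4 + j) + (4 + j)       ≤⟨ ℕ.+-monoˡ-≤ (4 + j) (ℕ.m≤n*m (big (4 + j)) 2) ⟩
  big (5 + j)                 ∎
  where
  open ℕ.≤-Reasoning
  shifted : ∀ j → 2 * (5 + j) ≡ 2 * (4 + j) + 2
  shifted = solve-∀

private
  -- With `t = 4 + j`, the right side minus the left is `4 * (α * β) + s * β + t * α - 2 * (s *
  -- t)`, and by `big-4+` the term `s * β` alone exceeds `2 * (s * t)`.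
  2mixed<3mixedExcess-4+ : ∀ {s} j → 0 < s → 2 * mixed s (4 + j) < 3 * mixedExcess s (4 + j)
  2mixed<3mixedExcess-4+ {suc i} j _ = ℕ.+-cancelʳ-< ((1 + i) * big (4 + j)) _ _ (begin-strict
    2 * mixed (1 + i) (4 + j) + (1 + i) * big (4 + j)
      ≤⟨ ≤-step-+ (4 * (α * β) + (4 + j) * α) (split α β (1 + i) (4 + j)) ⟩
    3 * mixedExcess (1 + i) (4 + j) + (1 + i) * (2 * (4 + j))
      <⟨ ℕ.+-monoʳ-< (3 * mixedExcess (1 + i) (4 + j)) (ℕ.*-monoʳ-< (1 + i) (big-4+ j)) ⟩
    3 * mixedExcess (1 + i) (4 + j) + (1 + i) * big (4 + j) ∎)
    where
    open ℕ.≤-Reasoning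
    α = big (1 + i)
    β = big (4 + j)
    split : ∀ α β s t → 2 * ((α + s) * (β + t)) + s * β + (4 * (α * β) + t * α)
                        ≡ 3 * (2 * (α * β) + s * β + t * α) + s * (2 * t)
    split = solve-∀

-- Once a part of order at least 4 is settled on either side, only `s = t = 3` remains. The lower
-- bound on `s + t` excludes orders 1 and 3, for which the inequality fails (14 against 12).
2mixed<3mixedExcess : ∀ s t → 0 < s → 0 < t → 6 ≤ℕ s + t →
                      2 * mixed s t < 3 * mixedExcess s t
2mixed<3mixedExcess s (suc (suc (suc (suc j)))) 0<s _ _ = 2mixed<3mixedExcess-4+ j 0<s
2mixed<3mixedExcess (suc (suc (suc (suc i)))) t _ 0<t _ =
  subst₂ _<_ (cong (2 *_) (mixed-comm t (4 + i))) (cong (3 *_) (mixedExcess-comm t (4 + i)))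
    (2mixed<3mixedExcess-4+ i 0<t)
2mixed<3mixedExcess 3 3 _ _ _ = ℕ.<ᵇ⇒< 98 168 _
2mixed<3mixedExcess 1 1 _ _ (s≤s (s≤s ()))
2mixed<3mixedExcess 1 2 _ _ (s≤s (s≤s (s≤s ())))
2mixed<3mixedExcess 1 3 _ _ (s≤s (s≤s (s≤s (s≤s ()))))
2mixed<3mixedExcess 2 1 _ _ (s≤s (s≤s (s≤s ())))
2mixed<3mixedExcess 2 2 _ _ (s≤s (s≤s (s≤s (s≤s ()))))
2mixed<3mixedExcess 2 3 _ _ (s≤s (s≤s (s≤s (s≤s (s≤s ())))))
2mixed<3mixedExcess 3 1 _ _ (s≤s (s≤s (s≤s (s≤s ()))))
2mixed<3mixedExcess 3 2 _ _ (s≤s (s≤s (s≤s (s≤s (s≤s ())))))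

3m²≤2^[1+m] : ∀ {m} → 6 ≤ℕ m → 3 * (m * m) ≤ℕ 2 * 2 ^ m
3m²≤2^[1+m] {m} 6≤m with k , refl ← ℕ.m≤n⇒∃[o]m+o≡n 6≤m = go k
  where
  open ℕ.≤-Reasoning
  expand : ∀ k → 3 * ((7 + k) * (7 + k)) + 3 * (k * k + 10 * k + 23) ≡ 2 * (3 * ((6 + k) * (6 + k)))
  expand = solve-∀
  go : ∀ k → 3 * ((6 + k) * (6 + k)) ≤ℕ 2 * 2 ^ (6 + k)
  go zero    = ℕ.m≤m+n 108 20
  go (suc k) = begin
    3 * ((7 + k) * (7 + k))       ≤⟨ ≤-step-+ _ (expand k) ⟩
    2 * (3 * ((6 + k) * (6 + k))) ≤⟨ ℕ.*-monoʳ-≤ 2 (go k) ⟩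
    2 * 2 ^ (7 + k)               ∎

-- The method reaches its limit here: at `m = 5` the two sides are 75 and 74, which is where the
-- restriction to at least seven vertices is felt.
3m²≤2κ : ∀ {m} → 6 ≤ℕ m → 3 * (m * m) ≤ℕ 2 * (2 ^ m + m)
3m²≤2κ {m} 6≤m = ℕ.≤-trans (3m²≤2^[1+m] 6≤m) (ℕ.*-monoʳ-≤ 2 (ℕ.m≤m+n (2 ^ m) m))

m²≤κ : ∀ {m} → 6 ≤ℕ m → m * m ≤ℕ 2 ^ m + m
m²≤κ {m} 6≤m = ℕ.*-cancelˡ-≤ 2 (ℕ.≤-trans (ℕ.*-monoˡ-≤ (m * m) (ℕ.n≤1+n 2)) (3m²≤2κ 6≤m))

-- ab ≥ st + (n-1)(n-2) with s = 2 + i and t = 2 + j, where n = s + t.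
Dominant : ℕ → ℕ → Set
Dominant i j = (2 + i) * (2 + j) + (3 + i + j) * (2 + i + j) ≤ℕ big (2 + i) * big (2 + j)

Dominant-comm : ∀ i j → Dominant i j → Dominant j i
Dominant-comm i j = subst₂ _≤ℕ_ (comm i j) (ℕ.*-comm (big (2 + i)) (big (2 + j)))
  where
  comm : ∀ i j → (2 + i) * (2 + j) + (3 + i + j) * (2 + i + j)
               ≡ (2 + j) * (2 + i) + (3 + j + i) * (2 + j + i)
  comm = solve-∀

-- From `j` to `suc j` the right side at least doubles, whereas the quadratic left side at most
-- doubles.
Dominant-suc : ∀ i j → Dominant i j → Dominant i (suc j)
Dominant-suc i j d = begin
  (2 + i) * (3 + j) + (3 + i + suc j) * (2 + i + suc j)
    ≤⟨ ≤-step-+ _ (doubled i j) ⟩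
  2 * ((2 + i) * (2 + j) + (3 + i + j) * (2 + i + j))
    ≤⟨ ℕ.*-monoʳ-≤ 2 d ⟩
  2 * (big (2 + i) * big (2 + j))
    ≤⟨ ≤-step-+ _ (step (big (2 + i)) (big (2 + j)) j) ⟩
  big (2 + i) * big (3 + j) ∎
  where
  open ℕ.≤-Reasoning
  doubled : ∀ i j → (2 + i) * (3 + j) + (3 + i + (1 + j)) * (2 + i + (1 + j))
                    + (i * i + j * j + 3 * (i * j) + 4 * i + 5 * j + 2)
                  ≡ 2 * ((2 + i) * (2 + j) + (3 + i + j) * (2 + i + j))
  doubled = solve-∀
  step : ∀ a b j → 2 * (a * b) + a * (2 + j) ≡ a * (2 * b + (2 + j))
  step = solve-∀

Dominant-+ʳ : ∀ i j k → Dominant i j → Dominant i (k + j)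
Dominant-+ʳ i j zero    d = d
Dominant-+ʳ i j (suc k) d = Dominant-suc i (k + j) (Dominant-+ʳ i j k d)

Dominant-+ : ∀ h k i j → Dominant i j → Dominant (h + i) (k + j)
Dominant-+ h k i j d =
  Dominant-+ʳ (h + i) j k (Dominant-comm j (h + i) (Dominant-+ʳ j i h (Dominant-comm i j d)))

private
  -- As `mixedExcess - mixed` is `α * β - s * t`, the equation says
  -- `D + s * t = (m + 1) * m + α * β`, and `Dominant` is precisely `2 * m² ≤ D`. For the count, 2 *
  -- 2^m = 2^s * 2^t already covers the sets that meet both parts, and what is left of `2 * κ`
  -- exceeds the `suc m` single vertices.
  gap-dominant : ∀ i j D → Dominant i j → let m = 3 + i + j in
    D + mixed (2 + i) (2 + j) ≡ suc m * m + mixedExcess (2 + i) (2 + j) →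
    m * m * (suc m + mixed (2 + i) (2 + j)) < D * (2 ^ m + m)
  gap-dominant i j D d eq = begin-strict
    m * m * (suc m + mixed s t)   <⟨ ℕ.*-monoʳ-< (m * m) N<2κ ⟩
    m * m * (2 * κ)               ≡⟨ ℕ.*-assoc (m * m) 2 κ ⟨
    m * m * 2 * κ                 ≤⟨ ℕ.*-monoˡ-≤ κ 2m²≤D ⟩
    D * κ                         ∎
    where
    open ℕ.≤-Reasoning
    m = 3 + i + j
    s = 2 + i
    t = 2 + j
    α = big s
    β = big t
    κ = 2 ^ m + m

    D+st : ∀ α β i j D → let s = 2 + i; t = 2 + j; m = 3 + i + j in
           D + (α + s) * (β + t) ≡ (1 + m) * m + (2 * (α * β) + s * β + t * α) →
           (D + s * t) + (α + s) * (β + t) ≡ ((1 + m) * m + α * β) + (α + s) * (β + t)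
    D+st α β i j D eq =
      trans (front α β i j D) (trans (cong (_+ (2 + i) * (2 + j)) eq) (back α β i j))
      where
      front : ∀ α β i j D → D + (2 + i) * (2 + j) + (α + (2 + i)) * (β + (2 + j))
                          ≡ D + (α + (2 + i)) * (β + (2 + j)) + (2 + i) * (2 + j)
      front = solve-∀
      back : ∀ α β i j → let s = 2 + i; t = 2 + j; m = 3 + i + j in
             (1 + m) * m + (2 * (α * β) + s * β + t * α) + s * t
             ≡ ((1 + m) * m + α * β) + (α + s) * (β + t)
      back = solve-∀

    2m²≤D : m * m * 2 ≤ℕ D
    2m²≤D = ℕ.+-cancelʳ-≤ (s * t) _ _ (begin
      m * m * 2 + s * t                          ≡⟨ regroup i j ⟩
      suc m * m + (s * t + m * (2 + i + j))      ≤⟨ ℕ.+-monoʳ-≤ (suc m * m) d ⟩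
      suc m * m + α * β                          ≡⟨ ℕ.+-cancelʳ-≡ (mixed s t) _ _ (D+st α β i j D eq) ⟨
      D + s * t                                  ∎)
      where
      regroup : ∀ i j → let s = 2 + i; t = 2 + j; m = 3 + i + j in
                m * m * 2 + s * t ≡ (1 + m) * m + (s * t + m * (2 + i + j))
      regroup = solve-∀

    2^n : 2 * 2 ^ m ≡ (α + s + 1) * (β + t + 1)
    2^n = trans (cong (2 ^_) (size i j))
            (trans (ℕ.^-distribˡ-+-* 2 s t) (cong₂ _*_ (2^≡big s) (2^≡big t)))
      where
      size : ∀ i j → 4 + i + j ≡ (2 + i) + (2 + j)
      size = solve-∀

    N<2κ : suc m + mixed s t < 2 * κ
    N<2κ = begin-strict
      suc m + mixed s t                              <⟨ ≤-step-+ _ (pad α β i j) ⟩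
      (α + s + 1) * (β + t + 1) + 2 * m              ≡⟨ cong (_+ 2 * m) 2^n ⟨
      2 * 2 ^ m + 2 * m                              ≡⟨ ℕ.*-distribˡ-+ 2 (2 ^ m) m ⟨
      2 * κ                                          ∎
      where
      pad : ∀ α β i j → let s = 2 + i; t = 2 + j; m = 3 + i + j in
            1 + (1 + m + (α + s) * (β + t)) + (α + β + s + t + 2 + i + j)
            ≡ (α + s + 1) * (β + t + 1) + 2 * m
      pad = solve-∀

-- `Dominant` is closed upwards, so every admissible pair other than {0 , 3} reduces to (0 , 4) or
-- (4 , 0), where it reads 54 ≤ 57, or to (1 , 2) or (2 , 1), where it reads 42 ≤ 44. At {0 , 3} it
-- fails, 40 against 26; there D = 42 + 109 - 93 = 58, N = 100 and κ = 70, so that 36 * 100 < 58 *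
-- 70 is checked as it stands.
gap-no-universal : ∀ i j D → let m = 3 + i + j in 6 ≤ℕ m →
  D + mixed (2 + i) (2 + j) ≡ suc m * m + mixedExcess (2 + i) (2 + j) →
  m * m * (suc m + mixed (2 + i) (2 + j)) < D * (2 ^ m + m)
gap-no-universal 0 0 D (s≤s (s≤s (s≤s ()))) eq
gap-no-universal 0 1 D (s≤s (s≤s (s≤s (s≤s ())))) eq
gap-no-universal 0 2 D (s≤s (s≤s (s≤s (s≤s (s≤s ()))))) eq
gap-no-universal 1 0 D (s≤s (s≤s (s≤s (s≤s ())))) eq
gap-no-universal 1 1 D (s≤s (s≤s (s≤s (s≤s (s≤s ()))))) eq
gap-no-universal 2 0 D (s≤s (s≤s (s≤s (s≤s (s≤s ()))))) eq
-- K₂,₅ is the only case below the bound D ≥ 2m².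
gap-no-universal 0 3 D _ eq =
  subst (λ D → 3600 < D * 70) (sym (ℕ.+-cancelʳ-≡ 93 D 58 eq)) (ℕ.m≤m+n 3601 459)
gap-no-universal 3 0 D _ eq =
  subst (λ D → 3600 < D * 70) (sym (ℕ.+-cancelʳ-≡ 93 D 58 eq)) (ℕ.m≤m+n 3601 459)
gap-no-universal 0 (suc (suc (suc (suc j)))) D _ =
  gap-dominant 0 (4 + j) D (subst (Dominant 0) (ℕ.+-comm j 4)
    (Dominant-+ 0 j 0 4 (ℕ.≤ᵇ⇒≤ 54 57 _)))
gap-no-universal (suc (suc (suc (suc i)))) 0 D _ =
  gap-dominant (4 + i) 0 D (subst (λ k → Dominant k 0) (ℕ.+-comm i 4)
    (Dominant-+ i 0 4 0 (ℕ.≤ᵇ⇒≤ 54 57 _)))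
gap-no-universal 1 (suc (suc j)) D _ =
  gap-dominant 1 (2 + j) D (subst (Dominant 1) (ℕ.+-comm j 2)
    (Dominant-+ 0 j 1 2 (ℕ.≤ᵇ⇒≤ 42 44 _)))
gap-no-universal (suc (suc i)) (suc j) D _ =
  gap-dominant (2 + i) (1 + j) D (subst₂ Dominant (ℕ.+-comm i 2) (ℕ.+-comm j 1)
    (Dominant-+ i j 2 1 (ℕ.≤ᵇ⇒≤ 42 44 _)))

-- Sums over subsets

⟦_⟧ : ∀ {A : Set} → Dec A → ℕ
⟦ yes _ ⟧ = 1
⟦ no  _ ⟧ = 0

⟦⟧-cong : ∀ {A B : Set} {A? : Dec A} {B? : Dec B} → (A → B) → (B → A) → ⟦ A? ⟧ ≡ ⟦ B? ⟧
⟦⟧-cong {A? = yes a} {yes b} f g = refl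
⟦⟧-cong {A? = yes a} {no ¬b} f g = contradiction (f a) ¬b
⟦⟧-cong {A? = no ¬a} {yes b} f g = contradiction (g b) ¬a
⟦⟧-cong {A? = no ¬a} {no ¬b} f g = refl

⟦⟧-yes : ∀ {A : Set} {A? : Dec A} → A → ⟦ A? ⟧ ≡ 1
⟦⟧-yes {A? = yes _} _  = refl
⟦⟧-yes {A? = no ¬a} a = contradiction a ¬a

⟦⟧-no : ∀ {A : Set} {A? : Dec A} → ¬ A → ⟦ A? ⟧ ≡ 0
⟦⟧-no {A? = yes a} ¬a = contradiction a ¬a
⟦⟧-no {A? = no _}  ¬a = refl

one : ℕ → ℕ
one _ = 1

module _ {A : Set} where

  sum-map-+ : ∀ (f g : A → ℕ) xs →
              sum (map (λ x → f x + g x) xs) ≡ sum (map f xs) + sum (map g xs)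
  sum-map-+ f g []       = refl
  sum-map-+ f g (x ∷ xs) =
    trans (cong (f x + g x +_) (sum-map-+ f g xs)) (interchange (f x) (g x) _ _)
    where
    interchange : ∀ a b c d → a + b + (c + d) ≡ a + c + (b + d)
    interchange = solve-∀

-- The weight sees a set only through its cardinality, so that one identity for `total` serves both
-- the number of sets (`one`) and the sum of their sizes (`id`).
total : ∀ {n} → (Subset n → ℕ) → (ℕ → ℕ) → ℕ
total {n} i w = sum (map (λ S → i S * w ∣ S ∣) (subsets n))

module _ {n : ℕ} where

  total-cong : ∀ (i j : Subset n → ℕ) w → (∀ S → i S ≡ j S) → total i w ≡ total j w
  total-cong i j w i≡j = cong sum (map-cong (λ S → cong (_* w ∣ S ∣) (i≡j S)) (subsets n))

  total-+ : ∀ (i j : Subset n → ℕ) w → total (λ S → i S + j S) w ≡ total i w + total j w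
  total-+ i j w = trans
    (cong sum (map-cong (λ S → ℕ.*-distribʳ-+ (w ∣ S ∣) (i S) (j S)) (subsets n)))
    (sum-map-+ _ _ (subsets n))

  total-+ʷ : ∀ (i : Subset n → ℕ) v w → total i (λ k → v k + w k) ≡ total i v + total i w
  total-+ʷ i v w = trans
    (cong sum (map-cong (λ S → ℕ.*-distribˡ-+ (i S) (v ∣ S ∣) (w ∣ S ∣)) (subsets n)))
    (sum-map-+ _ _ (subsets n))

  total-zero : ∀ w → total {n} (λ _ → 0) w ≡ 0
  total-zero w = zeros (subsets n)
    where
    zeros : ∀ (xs : List (Subset n)) → sum (map (λ S → 0) xs) ≡ 0
    zeros []       = refl
    zeros (_ ∷ xs) = zeros xs

  total-suc : ∀ (i : Subset (suc n) → ℕ) w →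
    total i w ≡ total (λ S → i (inside ∷ S)) (w ∘ suc) + total (λ S → i (outside ∷ S)) w
  total-suc i w = trans (cong sum (map-++ f (map (inside ∷_) (subsets n)) _))
    (trans (sum-++ (map f (map (inside ∷_) (subsets n))) _)
      (cong₂ (λ xs ys → sum xs + sum ys) (sym (map-∘ (subsets n))) (sym (map-∘ (subsets n)))))
    where
    f = λ S → i S * w ∣ S ∣

below : ∀ {n} → Subset n → Subset n → ℕ
below U S = ⟦ S ⊆? U ⟧

below-cong : ∀ {m n} {U S : Subset m} {V R : Subset n} →
             (S ⊆ U → R ⊆ V) → (R ⊆ V → S ⊆ U) → below U S ≡ below V R
below-cong {U = U} {S} {V} {R} f g = ⟦⟧-cong {A? = S ⊆? U} {B? = R ⊆? V} f g

below-no : ∀ {n} {U S : Subset n} → ¬ (S ⊆ U) → below U S ≡ 0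
below-no {U = U} {S} S⊈U = ⟦⟧-no {A? = S ⊆? U} S⊈U

total-below-inside : ∀ {n} (U : Subset n) w →
  total (below (inside ∷ U)) w ≡ total (below U) (w ∘ suc) + total (below U) w
total-below-inside U w = trans (total-suc (below (inside ∷ U)) w) (cong₂ _+_
  (total-cong _ (below U) (w ∘ suc) λ S →
    below-cong {U = inside ∷ U} {inside ∷ S} {U} {S} drop-∷-⊆ in⊆in)
  (total-cong _ (below U) w λ S →
    below-cong {U = inside ∷ U} {outside ∷ S} {U} {S} drop-∷-⊆ out⊆))

total-below-outside : ∀ {n} (U : Subset n) w →
  total (below (outside ∷ U)) w ≡ total (below U) w
total-below-outside {n} U w = trans (total-suc (below (outside ∷ U)) w) (cong₂ _+_
  (trans (total-cong _ (λ _ → 0) (w ∘ suc) λ S → below-no {S = inside ∷ S} inside⊈outside)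
         (total-zero {n} (w ∘ suc)))
  (total-cong _ (below U) w λ S →
    below-cong {U = outside ∷ U} {outside ∷ S} {U} {S} drop-∷-⊆ out⊆))
  where
  inside⊈outside : ∀ {S} → ¬ (inside ∷ S ⊆ outside ∷ U)
  inside⊈outside S⊆U with () ← S⊆U here

count-below : ∀ {n} (U : Subset n) → total (below U) one ≡ 2 ^ ∣ U ∣
count-below []            = refl
count-below (inside  ∷ U) = trans (total-below-inside U one)
  (trans (cong₂ _+_ (count-below U) (count-below U)) (double (2 ^ ∣ U ∣)))
  where
  double : ∀ x → x + x ≡ 2 * x
  double = solve-∀
count-below (outside ∷ U) = trans (total-below-outside U one) (count-below U)

2size-below : ∀ {n} (U : Subset n) → 2 * total (below U) id ≡ ∣ U ∣ * 2 ^ ∣ U ∣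
2size-below []            = refl
2size-below (inside  ∷ U) = begin
  2 * total (below (inside ∷ U)) id
    ≡⟨ cong (2 *_) (total-below-inside U id) ⟩
  2 * (total (below U) suc + total (below U) id)
    ≡⟨ cong (λ x → 2 * (x + total (below U) id)) (total-+ʷ (below U) one id) ⟩
  2 * (total (below U) one + total (below U) id + total (below U) id)
    ≡⟨ cong (λ x → 2 * (x + total (below U) id + total (below U) id)) (count-below U) ⟩
  2 * (2 ^ ∣ U ∣ + total (below U) id + total (below U) id)
    ≡⟨ regroup (2 ^ ∣ U ∣) (total (below U) id) ⟩
  2 * 2 ^ ∣ U ∣ + 2 * (2 * total (below U) id)
    ≡⟨ cong (λ x → 2 * 2 ^ ∣ U ∣ + 2 * x) (2size-below U) ⟩
  2 * 2 ^ ∣ U ∣ + 2 * (∣ U ∣ * 2 ^ ∣ U ∣)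
    ≡⟨ factor (2 ^ ∣ U ∣) ∣ U ∣ ⟩
  suc ∣ U ∣ * (2 * 2 ^ ∣ U ∣) ∎
  where
  open ≡-Reasoning
  regroup : ∀ x y → 2 * (x + y + y) ≡ 2 * x + 2 * (2 * y)
  regroup = solve-∀
  factor : ∀ x u → 2 * x + 2 * (u * x) ≡ (1 + u) * (2 * x)
  factor = solve-∀
2size-below (outside ∷ U) = trans (cong (2 *_) (total-below-outside U id)) (2size-below U)

-- Values of Φ and its derivative at 1 as sums over vertex sets

sum-applyUpTo-cong : ∀ {f g : ℕ → ℕ} → (∀ i → f i ≡ g i) → ∀ m →
                     sum (applyUpTo f m) ≡ sum (applyUpTo g m)
sum-applyUpTo-cong f≡g zero    = refl
sum-applyUpTo-cong f≡g (suc m) = cong₂ _+_ (f≡g 0) (sum-applyUpTo-cong (f≡g ∘ suc) m)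

sum-applyUpTo-+ : ∀ (f g : ℕ → ℕ) m →
  sum (applyUpTo (λ i → f i + g i) m) ≡ sum (applyUpTo f m) + sum (applyUpTo g m)
sum-applyUpTo-+ f g zero    = refl
sum-applyUpTo-+ f g (suc m) =
  trans (cong (f 0 + g 0 +_) (sum-applyUpTo-+ (f ∘ suc) (g ∘ suc) m))
        (interchange (f 0) (g 0) _ _)
  where
  interchange : ∀ a b c d → a + b + (c + d) ≡ a + c + (b + d)
  interchange = solve-∀

sum-applyUpTo-zero : ∀ {f : ℕ → ℕ} → (∀ i → f i ≡ 0) → ∀ m → sum (applyUpTo f m) ≡ 0
sum-applyUpTo-zero f≡0 zero    = refl
sum-applyUpTo-zero f≡0 (suc m) = cong₂ _+_ (f≡0 0) (sum-applyUpTo-zero (f≡0 ∘ suc) m)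

*⟦⟧-no : ∀ w {A : Set} {A? : Dec A} → ¬ A → w * ⟦ A? ⟧ ≡ 0
*⟦⟧-no w {A? = A?} ¬a = trans (cong (w *_) (⟦⟧-no {A? = A?} ¬a)) (ℕ.*-zeroʳ w)

sum-applyUpTo-unique : ∀ {P : ℕ → Set} (P? : ∀ i → Dec (P i)) (w : ℕ → ℕ) {j} →
  P j → (∀ {i} → P i → j ≡ i) → ∀ {m} → j < m →
  sum (applyUpTo (λ i → w i * ⟦ P? i ⟧) m) ≡ w j
sum-applyUpTo-unique P? w {zero} p uniq {suc m} _ with P? 0
... | no ¬p = contradiction p ¬p
... | yes _ = trans
  (cong₂ _+_ (ℕ.*-identityʳ (w 0))
    (sum-applyUpTo-zero (λ i → *⟦⟧-no (w (suc i)) (ℕ.0≢1+n ∘ uniq)) m))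
  (ℕ.+-identityʳ (w 0))
sum-applyUpTo-unique P? w {suc j} p uniq {suc m} (s≤s j<m) = cong₂ _+_
  (*⟦⟧-no (w 0) (ℕ.1+n≢0 ∘ uniq))
  (sum-applyUpTo-unique (P? ∘ suc) (w ∘ suc) p (ℕ.suc-injective ∘ uniq) j<m)

length-filter-∷ : ∀ {A : Set} {P : A → Set} (P? : ∀ x → Dec (P x)) x xs →
  length (filter P? (x ∷ xs)) ≡ ⟦ P? x ⟧ + length (filter P? xs)
length-filter-∷ P? x xs with P? x
... | yes _ = refl
... | no  _ = refl

module _ {A : Set} {C : A → Set} (C? : ∀ x → Dec (C x)) (size : A → ℕ) {n : ℕ}
         (size>0 : ∀ x → C x → 0 < size x) (size≤n : ∀ x → size x ≤ℕ n) (w : ℕ → ℕ) where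

  private
    P? : ∀ k x → Dec (size x ≡ k × C x)
    P? k x = (size x ℕ.≟ k) ×-dec C? x

    counts : List A → ℕ → ℕ
    counts xs i = w (suc i) * length (filter (P? (suc i)) xs)

    single : ∀ x → sum (applyUpTo (λ i → w (suc i) * ⟦ P? (suc i) x ⟧) n) ≡ ⟦ C? x ⟧ * w (size x)
    single x with C? x
    ... | no ¬c = sum-applyUpTo-zero (λ i → *⟦⟧-no (w (suc i)) (¬c ∘ proj₂)) n
    ... | yes c with size x | size>0 x c | size≤n x
    ... | suc j | _ | j<n = trans
      (sum-applyUpTo-unique (λ i → (suc j ℕ.≟ suc i) ×-dec yes c) (w ∘ suc)
        (refl , c) (ℕ.suc-injective ∘ proj₁) j<n)
      (sym (ℕ.*-identityˡ (w (suc j))))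

  -- Exchange of summations: an element satisfying `C` is seen by exactly one index on the left,
  -- namely `size x - 1`, which lies below `n` because sizes are positive and at most `n`. The
  -- weight `one` gives Φ(1), and `id` gives Φ'(1).
  sum-by-size : ∀ xs → sum (applyUpTo (λ i → w (suc i) * length (filter (P? (suc i)) xs)) n)
                       ≡ sum (map (λ x → ⟦ C? x ⟧ * w (size x)) xs)
  sum-by-size []       = sum-applyUpTo-zero (ℕ.*-zeroʳ ∘ w ∘ suc) n
  sum-by-size (x ∷ xs) = trans
    (sum-applyUpTo-cong (λ i → trans (cong (w (suc i) *_) (length-filter-∷ (P? (suc i)) x xs))
      (ℕ.*-distribˡ-+ (w (suc i)) ⟦ P? (suc i) x ⟧ _)) n)
    (trans (sum-applyUpTo-+ (λ i → w (suc i) * ⟦ P? (suc i) x ⟧) (counts xs) n)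
      (cong₂ _+_ (single x) (sum-by-size xs)))

eval-applyUpTo : ∀ f m → eval (applyUpTo f m) 1 ≡ sum (applyUpTo f m)
eval-applyUpTo f zero    = refl
eval-applyUpTo f (suc m) =
  cong (f 0 +_) (trans (ℕ.+-identityʳ _) (eval-applyUpTo (f ∘ suc) m))

zipWith-applyUpTo : ∀ (f g : ℕ → ℕ) m →
  zipWith _*_ (applyUpTo f m) (applyUpTo g m) ≡ applyUpTo (λ i → f i * g i) m
zipWith-applyUpTo f g zero    = refl
zipWith-applyUpTo f g (suc m) = cong (f 0 * g 0 ∷_) (zipWith-applyUpTo (f ∘ suc) (g ∘ suc) m)

Nonempty⇒0<∣∣ : ∀ {m} {S : Subset m} → Nonempty S → 0 < ∣ S ∣
Nonempty⇒0<∣∣ {S = S} (v , v∈S) = subst (_≤ℕ ∣ S ∣) (∣⁅x⁆∣≡1 v)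
  (p⊆q⇒∣p∣≤∣q∣ (λ x∈ → subst (_∈ S) (sym (x∈⁅y⁆⇒x≡y v x∈)) v∈S))

module _ {n} (G : Graph (Fin n)) where

  within : Subset n → Subset n → ℕ
  within U S = below U S * ⟦ connected? G S ⟧

  private
    total-⊤ : ∀ w → total (within Sub.⊤) w ≡ total (λ S → ⟦ connected? G S ⟧) w
    total-⊤ w = total-cong _ _ w λ S → trans
      (cong (_* ⟦ connected? G S ⟧) (⟦⟧-yes {A? = S ⊆? Sub.⊤} ⊆⊤))
      (ℕ.*-identityˡ ⟦ connected? G S ⟧)

    total-by-size : ∀ w → sum (applyUpTo (λ i → w (suc i) * a G (suc i)) n) ≡ total (within Sub.⊤) w
    total-by-size w = trans
      (sum-by-size (connected? G) ∣_∣ (λ S c → Nonempty⇒0<∣∣ (proj₁ c)) ∣p∣≤n w (subsets n))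
      (sym (total-⊤ w))

  eval-Φ : eval (Φ G) 1 ≡ total (within Sub.⊤) one
  eval-Φ = trans (ℕ.+-identityʳ _) (trans (eval-applyUpTo (a G ∘ suc) n)
    (trans (sum-applyUpTo-cong (λ i → sym (ℕ.*-identityˡ (a G (suc i)))) n) (total-by-size one)))

  eval-deriv-Φ : eval (deriv (Φ G)) 1 ≡ total (within Sub.⊤) id
  eval-deriv-Φ = trans
    (cong (λ k → eval (zipWith _*_ (applyUpTo suc k) (applyUpTo (a G ∘ suc) n)) 1)
          (length-applyUpTo (a G ∘ suc) n))
    (trans (cong (λ p → eval p 1) (zipWith-applyUpTo suc (a G ∘ suc) n))
      (trans (eval-applyUpTo (λ i → suc i * a G (suc i)) n) (total-by-size id)))

-- Decomposition of cographs

select : ∀ {n} {P : Fin n → Set} → (∀ x → Dec (P x)) → Subset n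
select P? = tabulate (does ∘ P?)

module _ {n} {P : Fin n → Set} (P? : ∀ x → Dec (P x)) where

  ∈-select⁺ : ∀ {x} → P x → x ∈ select P?
  ∈-select⁺ {x} p = lookup⇒[]= x _ (trans (lookup∘tabulate _ x) (dec-true (P? x) p))

  ∈-select⁻ : ∀ {x} → x ∈ select P? → P x
  ∈-select⁻ {x} x∈ with P? x | trans (sym (lookup∘tabulate (does ∘ P?) x)) ([]=⇒lookup x∈)
  ... | yes p | _ = p

record Partition {n} (U P Q : Subset n) : Set where
  field
    left     : P ⊆ U
    right    : Q ⊆ U
    cover    : ∀ {x} → x ∈ U → x ∈ P ⊎ x ∈ Q
    disjoint : ∀ {x} → x ∈ P → ¬ (x ∈ Q)
    leftNonempty  : Nonempty P
    rightNonempty : Nonempty Q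

open Partition

Partition-swap : ∀ {n} {U P Q : Subset n} → Partition U P Q → Partition U Q P
Partition-swap π = record
  { left = right π ; right = left π ; cover = swap ∘ cover π
  ; disjoint = λ x∈Q x∈P → disjoint π x∈P x∈Q
  ; leftNonempty = rightNonempty π ; rightNonempty = leftNonempty π }

Partition⇒⊂ : ∀ {n} {U P Q : Subset n} → Partition U P Q → P ⊂ U
Partition⇒⊂ π with (q , q∈Q) ← rightNonempty π =
  left π , q , right π q∈Q , λ q∈P → disjoint π q∈P q∈Q

∣∪∣-disjoint : ∀ {n} (P Q : Subset n) → (∀ {x} → x ∈ P → ¬ (x ∈ Q)) → ∣ P ∪ Q ∣ ≡ ∣ P ∣ + ∣ Q ∣
∣∪∣-disjoint []            []            _ = refl
∣∪∣-disjoint (inside  ∷ P) (inside  ∷ Q) d = contradiction here (d here)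
∣∪∣-disjoint (inside  ∷ P) (outside ∷ Q) d =
  cong suc (∣∪∣-disjoint P Q (λ p q → d (there p) (there q)))
∣∪∣-disjoint (outside ∷ P) (inside  ∷ Q) d =
  trans (cong suc (∣∪∣-disjoint P Q (λ p q → d (there p) (there q)))) (sym (ℕ.+-suc ∣ P ∣ ∣ Q ∣))
∣∪∣-disjoint (outside ∷ P) (outside ∷ Q) d = ∣∪∣-disjoint P Q (λ p q → d (there p) (there q))

∣partition∣ : ∀ {n} {U P Q : Subset n} → Partition U P Q → ∣ U ∣ ≡ ∣ P ∣ + ∣ Q ∣
∣partition∣ {U = U} {P} {Q} π = trans
  (cong ∣_∣ (⊆-antisym (x∈p∪q⁺ ∘ cover π) ([ left π , right π ]′ ∘ x∈p∪q⁻ P Q)))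
  (∣∪∣-disjoint P Q (disjoint π))

module _ {n} (G : Graph (Fin n)) where

  private
    _~_ = Adj G

  Complete Anticomplete : Subset n → Subset n → Set
  Complete     P Q = ∀ {x y} → x ∈ P → y ∈ Q → x ~ y
  Anticomplete P Q = ∀ {x y} → x ∈ P → y ∈ Q → ¬ (x ~ y)

  -- The cotree of an induced subgraph, with one node for each complement-or-graph disconnection.
  -- `U` is a parameter and a leaf carries an equation, since `⁅ v ⁆` as an index would obstruct
  -- matching.
  data Cotree (U : Subset n) : Set where
    leaf  : ∀ v → U ≡ ⁅ v ⁆ → Cotree U
    union : ∀ {P Q} → Partition U P Q → Anticomplete P Q → Cotree P → Cotree Q → Cotree U
    join  : ∀ {P Q} → Partition U P Q → Complete P Q → Cotree P → Cotree Q → Cotree U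

  -- Unlike an anticomplete partition, `A` and `B` need not cover `U`. Such a pair starts as two
  -- nonadjacent vertices and is grown until its union is maximal.
  record Separated (U A B : Subset n) : Set where
    field
      A⊆U  : A ⊆ U
      B⊆U  : B ⊆ U
      A∩B  : ∀ {x} → x ∈ A → ¬ (x ∈ B)
      A≠∅  : Nonempty A
      B≠∅  : Nonempty B
      apart : Anticomplete A B

  open Separated

  Separated-swap : ∀ {U A B} → Separated U A B → Separated U B A
  Separated-swap σ = record
    { A⊆U = B⊆U σ ; B⊆U = A⊆U σ ; A∩B = λ x∈B x∈A → A∩B σ x∈A x∈B
    ; A≠∅ = B≠∅ σ ; B≠∅ = A≠∅ σ ; apart = λ x∈B y∈A yx → apart σ y∈A x∈B (adj-sym G yx) }

  module _ (cograph : Cograph G) where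

    -- Distinctness of the four vertices is not assumed: adjacent ones differ by irreflexivity, and
    -- identifying two nonadjacent ones would turn one of the three edges into one of the three
    -- non-edges.
    no-induced-path : ∀ {w x y z} → w ~ x → x ~ y → y ~ z →
                      ¬ (w ~ y) → ¬ (w ~ z) → ¬ (x ~ z) → Empty.⊥
    no-induced-path {w} {x} {y} {z} wx xy yz ¬wy ¬wz ¬xz = cograph (mk↣ inj , λ u v → mk⇔ (to u v) (from u v))
      where
      f : Fin 4 → Fin n
      f zero                   = w
      f (suc zero)             = x
      f (suc (suc zero))       = y
      f (suc (suc (suc zero))) = z

      to : ∀ u v → Adj (path 4) u v → f u ~ f v
      to zero (suc zero) _ = wx
      to (suc zero) zero _ = adj-sym G wx
      to (suc zero) (suc (suc zero)) _ = xy
      to (suc (suc zero)) (suc zero) _ = adj-sym G xy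
      to (suc (suc zero)) (suc (suc (suc zero))) _ = yz
      to (suc (suc (suc zero))) (suc (suc zero)) _ = adj-sym G yz
      to zero zero (inj₁ ())
      to zero zero (inj₂ ())
      to zero (suc (suc zero)) (inj₁ ())
      to zero (suc (suc zero)) (inj₂ ())
      to zero (suc (suc (suc zero))) (inj₁ ())
      to zero (suc (suc (suc zero))) (inj₂ ())
      to (suc zero) (suc zero) (inj₁ ())
      to (suc zero) (suc zero) (inj₂ ())
      to (suc zero) (suc (suc (suc zero))) (inj₁ ())
      to (suc zero) (suc (suc (suc zero))) (inj₂ ())
      to (suc (suc zero)) zero (inj₁ ())
      to (suc (suc zero)) zero (inj₂ ())
      to (suc (suc zero)) (suc (suc zero)) (inj₁ ())
      to (suc (suc zero)) (suc (suc zero)) (inj₂ ())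
      to (suc (suc (suc zero))) zero (inj₁ ())
      to (suc (suc (suc zero))) zero (inj₂ ())
      to (suc (suc (suc zero))) (suc zero) (inj₁ ())
      to (suc (suc (suc zero))) (suc zero) (inj₂ ())
      to (suc (suc (suc zero))) (suc (suc (suc zero))) (inj₁ ())
      to (suc (suc (suc zero))) (suc (suc (suc zero))) (inj₂ ())

      from : ∀ u v → f u ~ f v → Adj (path 4) u v
      from zero (suc zero) _ = inj₁ refl
      from (suc zero) zero _ = inj₂ refl
      from (suc zero) (suc (suc zero)) _ = inj₁ refl
      from (suc (suc zero)) (suc zero) _ = inj₂ refl
      from (suc (suc zero)) (suc (suc (suc zero))) _ = inj₁ refl
      from (suc (suc (suc zero))) (suc (suc zero)) _ = inj₂ refl
      from zero zero e = contradiction e (adj-irrefl G refl)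
      from zero (suc (suc zero)) e = contradiction e ¬wy
      from zero (suc (suc (suc zero))) e = contradiction e ¬wz
      from (suc zero) (suc zero) e = contradiction e (adj-irrefl G refl)
      from (suc zero) (suc (suc (suc zero))) e = contradiction e ¬xz
      from (suc (suc zero)) zero e = contradiction (adj-sym G e) ¬wy
      from (suc (suc zero)) (suc (suc zero)) e = contradiction e (adj-irrefl G refl)
      from (suc (suc (suc zero))) zero e = contradiction (adj-sym G e) ¬wz
      from (suc (suc (suc zero))) (suc zero) e = contradiction (adj-sym G e) ¬xz
      from (suc (suc (suc zero))) (suc (suc (suc zero))) e = contradiction e (adj-irrefl G refl)

      inj : ∀ {u v} → f u ≡ f v → u ≡ v
      inj {u} {v} eq with u ≟ v
      ... | yes u≡v = u≡v
      ... | no  u≢v = contradiction eq (distinct u v u≢v)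
        where
        x≢y : ∀ {x y} → x ~ y → x ≢ y
        x≢y e refl = adj-irrefl G refl e
        distinct : ∀ u v → u ≢ v → f u ≢ f v
        distinct zero (suc zero) _ = x≢y wx
        distinct (suc zero) zero _ = x≢y wx ∘ sym
        distinct (suc zero) (suc (suc zero)) _ = x≢y xy
        distinct (suc (suc zero)) (suc zero) _ = x≢y xy ∘ sym
        distinct (suc (suc zero)) (suc (suc (suc zero))) _ = x≢y yz
        distinct (suc (suc (suc zero))) (suc (suc zero)) _ = x≢y yz ∘ sym
        distinct zero zero n = contradiction refl n
        distinct zero (suc (suc zero)) _ refl = ¬wz yz
        distinct zero (suc (suc (suc zero))) _ refl = ¬wy (adj-sym G yz)
        distinct (suc zero) (suc zero) n = contradiction refl n
        distinct (suc zero) (suc (suc (suc zero))) _ refl = ¬wz wx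
        distinct (suc (suc zero)) zero _ refl = ¬wz yz
        distinct (suc (suc zero)) (suc (suc zero)) n = contradiction refl n
        distinct (suc (suc (suc zero))) zero _ refl = ¬wy (adj-sym G yz)
        distinct (suc (suc (suc zero))) (suc zero) _ refl = ¬wz wx
        distinct (suc (suc (suc zero))) (suc (suc (suc zero))) n = contradiction refl n

    Larger : Subset n → Subset n → Subset n → Set
    Larger U A B = ∃₂ λ A′ B′ → Separated U A′ B′ × A ∪ B ⊂ A′ ∪ B′

    -- Otherwise an edge yz from A ∩ N(s) to A ∖ N(s) and a neighbour w ∈ B of s
    -- give the induced path w, s, y, z.
    enlarge : ∀ {U A B s x} → Separated U A B → s ∈ U → ¬ (s ∈ A) → ¬ (s ∈ B) →
              x ∈ A → ¬ (s ~ x) → Larger U A B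
    enlarge {U} {A} {B} {s} {x} σ s∈U s∉A s∉B x∈A ¬sx
      with any? (λ y → any? (λ z → (y ∈? A) ×-dec (adj? G s y ×-dec
             ((z ∈? A) ×-dec (¬? (adj? G s z) ×-dec adj? G y z)))))
         | any? (λ w → (w ∈? B) ×-dec adj? G s w)
    ... | yes (y , z , y∈A , sy , z∈A , ¬sz , yz) | yes (w , w∈B , sw) =
      Empty.⊥-elim (no-induced-path (adj-sym G sw) sy yz
        (apart σ y∈A w∈B ∘ adj-sym G) (apart σ z∈A w∈B ∘ adj-sym G) ¬sz)
    -- `s` has no neighbour in `B`, so it can be added to `A`.
    ... | yes _ | no none = A ∪ ⁅ s ⁆ , B , σ′ , grown
      where
      ∈A∪s : ∀ {v} → v ∈ A ∪ ⁅ s ⁆ → v ∈ A ⊎ v ≡ s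
      ∈A∪s v∈ with x∈p∪q⁻ A ⁅ s ⁆ v∈
      ... | inj₁ v∈A = inj₁ v∈A
      ... | inj₂ v∈s = inj₂ (x∈⁅y⁆⇒x≡y s v∈s)

      σ′ : Separated U (A ∪ ⁅ s ⁆) B
      σ′ = record
        { A⊆U = λ v∈ → [ A⊆U σ , (λ { refl → s∈U }) ]′ (∈A∪s v∈)
        ; B⊆U = B⊆U σ
        ; A∩B = λ v∈ → [ A∩B σ , (λ { refl → s∉B }) ]′ (∈A∪s v∈)
        ; A≠∅ = x , p⊆p∪q ⁅ s ⁆ x∈A
        ; B≠∅ = B≠∅ σ
        ; apart = λ v∈ y∈B vy →
            [ (λ v∈A → apart σ v∈A y∈B vy) , (λ { refl → none (_ , y∈B , vy) }) ]′ (∈A∪s v∈) }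

      grown : A ∪ B ⊂ (A ∪ ⁅ s ⁆) ∪ B
      grown = (λ v∈ → [ p⊆p∪q B ∘ p⊆p∪q ⁅ s ⁆ , q⊆p∪q (A ∪ ⁅ s ⁆) B ]′ (x∈p∪q⁻ A B v∈))
            , s , p⊆p∪q B (q⊆p∪q A ⁅ s ⁆ (x∈⁅x⁆ s)) , (λ s∈ → [ s∉A , s∉B ]′ (x∈p∪q⁻ A B s∈))
    -- No edge joins A ∩ N(s) to A ∖ N(s). Hence A ∖ N(s), which contains `x`, is still separated
    -- after `s` and A ∩ N(s) have moved to the side of `B`.
    ... | no none | _ = A′ , B′ , σ′ , grown
      where
      inA′? : ∀ v → Dec (v ∈ A × ¬ (s ~ v))
      inA′? v = (v ∈? A) ×-dec ¬? (adj? G s v)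
      inB′? : ∀ v → Dec (v ∈ B ⊎ (v ∈ A × s ~ v) ⊎ v ≡ s)
      inB′? v = (v ∈? B) ⊎-dec (((v ∈? A) ×-dec adj? G s v) ⊎-dec (v ≟ s))

      A′ B′ : Subset n
      A′ = select inA′?
      B′ = select inB′?

      σ′ : Separated U A′ B′
      σ′ = record
        { A⊆U = A⊆U σ ∘ proj₁ ∘ ∈-select⁻ inA′?
        ; B⊆U = λ v∈ → [ B⊆U σ , [ A⊆U σ ∘ proj₁ , (λ { refl → s∈U }) ]′ ]′ (∈-select⁻ inB′? v∈)
        ; A∩B = λ v∈ v∈′ → let v∈A , ¬sv = ∈-select⁻ inA′? v∈ in
            [ A∩B σ v∈A , [ ¬sv ∘ proj₂ , (λ { refl → s∉A v∈A }) ]′ ]′ (∈-select⁻ inB′? v∈′)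
        ; A≠∅ = x , ∈-select⁺ inA′? (x∈A , ¬sx)
        ; B≠∅ = s , ∈-select⁺ inB′? (inj₂ (inj₂ refl))
        ; apart = λ z∈ y∈ zy → let z∈A , ¬sz = ∈-select⁻ inA′? z∈ in
            [ (λ y∈B → apart σ z∈A y∈B zy)
            , [ (λ (y∈A , sy) → none (_ , _ , y∈A , sy , z∈A , ¬sz , adj-sym G zy))
              , (λ { refl → ¬sz (adj-sym G zy) }) ]′ ]′ (∈-select⁻ inB′? y∈) }

      kept : ∀ {v} → v ∈ A → v ∈ A′ ∪ B′
      kept {v} v∈A with adj? G s v
      ... | yes sv = q⊆p∪q A′ B′ (∈-select⁺ inB′? (inj₂ (inj₁ (v∈A , sv))))
      ... | no ¬sv = p⊆p∪q B′ (∈-select⁺ inA′? (v∈A , ¬sv))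

      grown : A ∪ B ⊂ A′ ∪ B′
      grown = (λ v∈ → [ kept , q⊆p∪q A′ B′ ∘ ∈-select⁺ inB′? ∘ inj₁ ]′ (x∈p∪q⁻ A B v∈))
            , s , q⊆p∪q A′ B′ (∈-select⁺ inB′? (inj₂ (inj₂ refl)))
            , (λ s∈ → [ s∉A , s∉B ]′ (x∈p∪q⁻ A B s∈))

    Split : Subset n → Set
    Split U = ∃₂ λ P Q → Partition U P Q × (Anticomplete P Q ⊎ Complete P Q)

    -- Once A ∪ B is maximal, the rest of U is complete to A ∪ B.
    split-separated : ∀ {U A B} → Acc _⊃_ (A ∪ B) → Separated U A B → Split U
    split-separated {U} {A} {B} (acc rec) σ
      with any? (λ s → (s ∈? U) ×-dec (¬? (s ∈? A) ×-dec (¬? (s ∈? B) ×-dec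
             any? (λ x → (x ∈? A ∪ B) ×-dec ¬? (adj? G s x)))))
    ... | yes (s , s∈U , s∉A , s∉B , x , x∈ , ¬sx) with x∈p∪q⁻ A B x∈
    ...   | inj₁ x∈A with (A′ , B′ , σ′ , larger) ← enlarge σ s∈U s∉A s∉B x∈A ¬sx =
      split-separated (rec larger) σ′
    ...   | inj₂ x∈B with (A′ , B′ , σ′ , larger) ← enlarge (Separated-swap σ) s∈U s∉B s∉A x∈B ¬sx =
      split-separated (rec (subst (_⊂ A′ ∪ B′) (∪-comm B A) larger)) σ′
    split-separated {U} {A} {B} _ σ | no none
      with any? (λ s → (s ∈? U) ×-dec ¬? (s ∈? A ∪ B))
    ... | no empty = A , B , record
      { left = A⊆U σ ; right = B⊆U σ
      ; cover = λ {x} x∈U → x∈p∪q⁻ A B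
          (decidable-stable (x ∈? A ∪ B) (λ x∉ → empty (x , x∈U , x∉)))
      ; disjoint = A∩B σ ; leftNonempty = A≠∅ σ ; rightNonempty = B≠∅ σ } , inj₁ (apart σ)
    ... | yes (s , s∈U , s∉) = select rest? , A ∪ B , record
      { left = proj₁ ∘ ∈-select⁻ rest?
      ; right = [ A⊆U σ , B⊆U σ ]′ ∘ x∈p∪q⁻ A B
      ; cover = covered
      ; disjoint = proj₂ ∘ ∈-select⁻ rest?
      ; leftNonempty = s , ∈-select⁺ rest? (s∈U , s∉)
      ; rightNonempty = proj₁ (A≠∅ σ) , p⊆p∪q B (proj₂ (A≠∅ σ)) } , inj₂ complete
      where
      rest? : ∀ v → Dec (v ∈ U × ¬ (v ∈ A ∪ B))
      rest? v = (v ∈? U) ×-dec ¬? (v ∈? A ∪ B)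

      covered : ∀ {v} → v ∈ U → v ∈ select rest? ⊎ v ∈ A ∪ B
      covered {v} v∈U with v ∈? A ∪ B
      ... | yes v∈ = inj₂ v∈
      ... | no  v∉ = inj₁ (∈-select⁺ rest? (v∈U , v∉))

      complete : Complete (select rest?) (A ∪ B)
      complete {v} {y} v∈ y∈ = decidable-stable (adj? G v y) λ ¬vy →
        let v∈U , v∉ = ∈-select⁻ rest? v∈ in
        none (v , v∈U , v∉ ∘ p⊆p∪q B , v∉ ∘ q⊆p∪q A B , y , y∈ , ¬vy)

    -- A nonadjacent pair in `U` is the seed of a separation. Without such a pair `U` is a clique,
    -- and any one vertex is complete to the rest.
    split : ∀ {U x y} → x ∈ U → y ∈ U → x ≢ y → Split U
    split {U} {x} {y} x∈U y∈U x≢y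
      with any? (λ v → any? (λ w → (v ∈? U) ×-dec ((w ∈? U) ×-dec
             (¬? (v ≟ w) ×-dec ¬? (adj? G v w)))))
    ... | yes (v , w , v∈U , w∈U , v≢w , ¬vw) = split-separated (⊃-wellFounded _) (record
      { A⊆U = λ z∈ → subst (_∈ U) (sym (x∈⁅y⁆⇒x≡y v z∈)) v∈U
      ; B⊆U = λ z∈ → subst (_∈ U) (sym (x∈⁅y⁆⇒x≡y w z∈)) w∈U
      ; A∩B = λ z∈v z∈w → v≢w (trans (sym (x∈⁅y⁆⇒x≡y v z∈v)) (x∈⁅y⁆⇒x≡y w z∈w))
      ; A≠∅ = v , x∈⁅x⁆ v
      ; B≠∅ = w , x∈⁅x⁆ w
      ; apart = λ a∈ b∈ ab → ¬vw (subst₂ _~_ (x∈⁅y⁆⇒x≡y v a∈) (x∈⁅y⁆⇒x≡y w b∈) ab) })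
    ... | no none = ⁅ x ⁆ , select rest? , record
      { left = λ z∈ → subst (_∈ U) (sym (x∈⁅y⁆⇒x≡y x z∈)) x∈U
      ; right = proj₁ ∘ ∈-select⁻ rest?
      ; cover = covered
      ; disjoint = λ z∈ z∈′ → proj₂ (∈-select⁻ rest? z∈′) (x∈⁅y⁆⇒x≡y x z∈)
      ; leftNonempty = x , x∈⁅x⁆ x
      ; rightNonempty = y , ∈-select⁺ rest? (y∈U , x≢y ∘ sym) } , inj₂ complete
      where
      rest? : ∀ v → Dec (v ∈ U × v ≢ x)
      rest? v = (v ∈? U) ×-dec ¬? (v ≟ x)

      covered : ∀ {v} → v ∈ U → v ∈ ⁅ x ⁆ ⊎ v ∈ select rest?
      covered {v} v∈U with v ≟ x
      ... | yes refl = inj₁ (x∈⁅x⁆ v)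
      ... | no  v≢x  = inj₂ (∈-select⁺ rest? (v∈U , v≢x))

      complete : Complete ⁅ x ⁆ (select rest?)
      complete {v} {w} v∈ w∈ with refl ← x∈⁅y⁆⇒x≡y x v∈ = decidable-stable (adj? G x w) λ ¬xw →
        let w∈U , w≢x = ∈-select⁻ rest? w∈ in none (x , w , x∈U , w∈U , w≢x ∘ sym , ¬xw)

    cotree : ∀ U → Acc _⊂_ U → Nonempty U → Cotree U
    cotree U (acc rec) (v , v∈U) with any? (λ y → (y ∈? U) ×-dec ¬? (y ≟ v))
    ... | no alone = leaf v (⊆-antisym
      (λ {y} y∈U → subst (_∈ ⁅ v ⁆) (sym (decidable-stable (y ≟ v) (λ y≢v → alone (y , y∈U , y≢v))))
                         (x∈⁅x⁆ v))
      (λ y∈ → subst (_∈ U) (sym (x∈⁅y⁆⇒x≡y v y∈)) v∈U))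
    ... | yes (y , y∈U , y≢v) with split y∈U v∈U y≢v
    ...   | P , Q , π , rel
          with p ← cotree P (rec (Partition⇒⊂ π)) (leftNonempty π)
             | q ← cotree Q (rec (Partition⇒⊂ (Partition-swap π))) (rightNonempty π)
          with rel
    ...     | inj₁ anti = union π anti p q
    ...     | inj₂ comp = join π comp p q

-- Counting connected sets along a cotree

∈-or-⊆ : ∀ {n} (S Q : Subset n) → (∃ λ x → x ∈ S × ¬ (x ∈ Q)) ⊎ S ⊆ Q
∈-or-⊆ S Q with any? (λ x → (x ∈? S) ×-dec ¬? (x ∈? Q))
... | yes found = inj₁ found
... | no  none  = inj₂ λ {x} x∈S → decidable-stable (x ∈? Q) (λ x∉Q → none (x , x∈S , x∉Q))

-- `O` stands for the empty set. A set meeting both sides is connected, so `U` and `C` agree there;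
-- a nonempty set inside one side contributes its own `C` and 1 to both members; the empty set lies
-- in both sides, which gives 0 + 2 = 1 + 0 + 1. The leading clauses discard the inconsistent rows
-- of the truth table.
join-indicators : ∀ {U P Q O C : Set} (U? : Dec U) (P? : Dec P) (Q? : Dec Q) (O? : Dec O) (C? : Dec C) →
  (P → U) → (Q → U) → (O → P) → (O → Q) → (P → Q → O) → (O → ¬ C) → (U → ¬ P → ¬ Q → C) →
  ⟦ U? ⟧ * ⟦ C? ⟧ + (⟦ P? ⟧ + ⟦ Q? ⟧) ≡ ⟦ U? ⟧ + (⟦ P? ⟧ * ⟦ C? ⟧ + ⟦ Q? ⟧ * ⟦ C? ⟧ + ⟦ O? ⟧)
join-indicators (no ¬u) (yes p) _ _ _ pu _ _ _ _ _ _ = contradiction (pu p) ¬u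
join-indicators (no ¬u) (no _) (yes q) _ _ _ qu _ _ _ _ _ = contradiction (qu q) ¬u
join-indicators _ (no ¬p) _ (yes o) _ _ _ op _ _ _ _ = contradiction (op o) ¬p
join-indicators _ _ (no ¬q) (yes o) _ _ _ _ oq _ _ _ = contradiction (oq o) ¬q
join-indicators _ (yes p) (yes q) (no ¬o) _ _ _ _ _ pqo _ _ = contradiction (pqo p q) ¬o
join-indicators _ _ _ (yes o) (yes c) _ _ _ _ _ oc _ = contradiction c (oc o)
join-indicators (yes u) (no ¬p) (no ¬q) _ (no ¬c) _ _ _ _ _ _ uc = contradiction (uc u ¬p ¬q) ¬c
join-indicators (yes _) (yes _) (yes _) (yes _) (no _) _ _ _ _ _ _ _ = refl
join-indicators (yes _) (yes _) (no _) (no _) (yes _) _ _ _ _ _ _ _ = refl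
join-indicators (yes _) (yes _) (no _) (no _) (no _) _ _ _ _ _ _ _ = refl
join-indicators (yes _) (no _) (yes _) (no _) (yes _) _ _ _ _ _ _ _ = refl
join-indicators (yes _) (no _) (yes _) (no _) (no _) _ _ _ _ _ _ _ = refl
join-indicators (yes _) (no _) (no _) (no _) (yes _) _ _ _ _ _ _ _ = refl
join-indicators (no _) (no _) (no _) (no _) _ _ _ _ _ _ _ _ = refl

-- The empty set, the only one inside both sides, is not connected, so nothing is counted twice and
-- no correction term appears.
union-indicators : ∀ {U P Q C : Set} (U? : Dec U) (P? : Dec P) (Q? : Dec Q) (C? : Dec C) →
  (P → U) → (Q → U) → (P → Q → ¬ C) → (U → C → P ⊎ Q) →
  ⟦ U? ⟧ * ⟦ C? ⟧ ≡ ⟦ P? ⟧ * ⟦ C? ⟧ + ⟦ Q? ⟧ * ⟦ C? ⟧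
union-indicators (no ¬u) (yes p) _ _ pu _ _ _ = contradiction (pu p) ¬u
union-indicators (no ¬u) _ (yes q) _ _ qu _ _ = contradiction (qu q) ¬u
union-indicators _ (yes p) (yes q) (yes c) _ _ pqc _ = contradiction c (pqc p q)
union-indicators (yes u) (no ¬p) (no ¬q) (yes c) _ _ _ uc = contradiction (uc u c) [ ¬p , ¬q ]′
union-indicators (yes _) (yes _) (no _) (yes _) _ _ _ _ = refl
union-indicators (yes _) (no _) (yes _) (yes _) _ _ _ _ = refl
union-indicators (no _) (no _) (no _) (yes _) _ _ _ _ = refl
union-indicators (yes _) (yes _) (yes _) (no _) _ _ _ _ = refl
union-indicators (yes _) (yes _) (no _) (no _) _ _ _ _ = refl
union-indicators (yes _) (no _) (yes _) (no _) _ _ _ _ = refl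
union-indicators (yes _) (no _) (no _) (no _) _ _ _ _ = refl
union-indicators (no _) (no _) (no _) (no _) _ _ _ _ = refl

leaf-indicators : ∀ {U O C : Set} (U? : Dec U) (O? : Dec O) (C? : Dec C) →
  (O → U) → (O → ¬ C) → (U → ¬ O → C) → ⟦ U? ⟧ * ⟦ C? ⟧ + ⟦ O? ⟧ ≡ ⟦ U? ⟧
leaf-indicators (no ¬u) (yes o) _ ou _ _ = contradiction (ou o) ¬u
leaf-indicators _ (yes o) (yes c) _ oc _ = contradiction c (oc o)
leaf-indicators (yes u) (no ¬o) (no ¬c) _ _ uc = contradiction (uc u ¬o) ¬c
leaf-indicators (yes _) (yes _) (no _) _ _ _ = refl
leaf-indicators (yes _) (no _) (yes _) _ _ _ = refl
leaf-indicators (no _) (no _) (yes _) _ _ _ = refl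
leaf-indicators (no _) (no _) (no _) _ _ _ = refl

module _ {n} (G : Graph (Fin n)) where

  ConnectedOn : Subset n → Set
  ConnectedOn S = Connected (induced G (_∈ S))

  ⊆⊥⇒¬Connected : ∀ {S} → S ⊆ ⊥ → ¬ ConnectedOn S
  ⊆⊥⇒¬Connected S⊆⊥ ((v , v∈S) , _) = ∉⊥ (S⊆⊥ v∈S)

  stays-left : ∀ {U P Q S} → Partition U P Q → Anticomplete G P Q → S ⊆ U →
               ∀ {x y} → Star (Adj (induced G (_∈ S))) x y → proj₁ x ∈ P → proj₁ y ∈ P
  stays-left π anti S⊆U ε x∈P = x∈P
  stays-left π anti S⊆U {x} (_◅_ {j = z , z∈S} xz walk) x∈P with cover π (S⊆U z∈S)
  ... | inj₁ z∈P = stays-left π anti S⊆U walk z∈P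
  ... | inj₂ z∈Q = contradiction xz (anti x∈P z∈Q)

  connected-one-sided : ∀ {U P Q S} → Partition U P Q → Anticomplete G P Q → S ⊆ U →
                        ConnectedOn S → S ⊆ P ⊎ S ⊆ Q
  connected-one-sided {P = P} {Q} {S} π anti S⊆U (_ , walk) with ∈-or-⊆ S Q
  ... | inj₂ S⊆Q = inj₂ S⊆Q
  ... | inj₁ (x , x∈S , x∉Q) with cover π (S⊆U x∈S)
  ...   | inj₂ x∈Q = contradiction x∈Q x∉Q
  ...   | inj₁ x∈P = inj₁ λ {y} y∈S → stays-left π anti S⊆U (walk (x , x∈S) (y , y∈S)) x∈P

  -- `S` has a vertex `p` in `P` and a vertex `q` in `Q`. Vertices on opposite sides are adjacent,
  -- and two on the same side are linked through `q` or `p`.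
  two-sided-connected : ∀ {U P Q S} → Partition U P Q → Complete G P Q → S ⊆ U →
                        ¬ (S ⊆ P) → ¬ (S ⊆ Q) → ConnectedOn S
  two-sided-connected {P = P} {Q} {S} π comp S⊆U S⊈P S⊈Q with ∈-or-⊆ S P | ∈-or-⊆ S Q
  ... | inj₂ S⊆P | _ = contradiction (λ {x} → S⊆P {x}) S⊈P
  ... | _ | inj₂ S⊆Q = contradiction (λ {x} → S⊆Q {x}) S⊈Q
  ... | inj₁ (q , q∈S , q∉P) | inj₁ (p , p∈S , p∉Q)
    with cover π (S⊆U q∈S) | cover π (S⊆U p∈S)
  ... | inj₁ q∈P | _ = contradiction q∈P q∉P
  ... | _ | inj₂ p∈Q = contradiction p∈Q p∉Q
  ... | inj₂ q∈Q | inj₁ p∈P = (p , p∈S) , walk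
    where
    walk : ∀ u v → Star (Adj (induced G (_∈ S))) u v
    walk (u , u∈S) (v , v∈S) with cover π (S⊆U u∈S) | cover π (S⊆U v∈S)
    ... | inj₁ u∈P | inj₁ v∈P =
      _◅_ {j = q , q∈S} (comp u∈P q∈Q) (adj-sym G (comp v∈P q∈Q) ◅ ε)
    ... | inj₁ u∈P | inj₂ v∈Q = comp u∈P v∈Q ◅ ε
    ... | inj₂ u∈Q | inj₁ v∈P = adj-sym G (comp v∈P u∈Q) ◅ ε
    ... | inj₂ u∈Q | inj₂ v∈Q =
      _◅_ {j = p , p∈S} (adj-sym G (comp p∈P u∈Q)) (comp p∈P v∈Q ◅ ε)

  -- The number of connected sets with at least two vertices.
  extra : ∀ {U} → Cotree G U → ℕ
  extra (leaf _ _) = 0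
  extra (union _ _ p q) = extra p + extra q
  extra (join {P} {Q} _ _ p q) = extra p + extra q + mixed ∣ P ∣ ∣ Q ∣

  -- The sum of ∣ U ∣ + 2 - 2 ∣ S ∣ over the connected sets S with at least two vertices.
  excess : ∀ {U} → Cotree G U → ℕ
  excess (leaf _ _) = 0
  excess (union {P} {Q} _ _ p q) = excess p + excess q + (∣ Q ∣ * extra p + ∣ P ∣ * extra q)
  excess (join {P} {Q} _ _ p q) =
    excess p + excess q + (∣ Q ∣ * extra p + ∣ P ∣ * extra q) + mixedExcess ∣ P ∣ ∣ Q ∣

  total-union : ∀ {U P Q} → Partition U P Q → Anticomplete G P Q → ∀ w →
                total (within G U) w ≡ total (within G P) w + total (within G Q) w
  total-union {U} {P} {Q} π anti w = trans
    (total-cong (within G U) (λ S → within G P S + within G Q S) w λ S →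
      union-indicators (S ⊆? U) (S ⊆? P) (S ⊆? Q) (connected? G S)
        (λ S⊆P {x} x∈S → left π (S⊆P x∈S)) (λ S⊆Q {x} x∈S → right π (S⊆Q x∈S))
        (λ S⊆P S⊆Q c → disjoint π (S⊆P (proj₂ (proj₁ c))) (S⊆Q (proj₂ (proj₁ c))))
        (connected-one-sided π anti))
    (total-+ (within G P) (within G Q) w)

  -- Inclusion and exclusion with the negative terms moved across: among all subsets of `U`, those
  -- inside one part are replaced by the connected ones, and `⊥` repairs the empty set, which is
  -- taken away twice.
  total-join : ∀ {U P Q} → Partition U P Q → Complete G P Q → ∀ w →
    total (within G U) w + (total (below P) w + total (below Q) w)
    ≡ total (below U) w + (total (within G P) w + total (within G Q) w + total (below {n} ⊥) w)
  total-join {U} {P} {Q} π comp w = trans (sym lhs) (trans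
    (total-cong (λ S → within G U S + (below P S + below Q S))
                (λ S → below U S + (within G P S + within G Q S + below ⊥ S)) w λ S →
      join-indicators (S ⊆? U) (S ⊆? P) (S ⊆? Q) (S ⊆? ⊥) (connected? G S)
        (λ S⊆P {x} x∈S → left π (S⊆P x∈S)) (λ S⊆Q {x} x∈S → right π (S⊆Q x∈S))
        (λ S⊆⊥ {x} x∈S → contradiction (S⊆⊥ x∈S) ∉⊥) (λ S⊆⊥ {x} x∈S → contradiction (S⊆⊥ x∈S) ∉⊥)
        (λ S⊆P S⊆Q {x} x∈S → contradiction (S⊆Q x∈S) (disjoint π (S⊆P x∈S)))
        ⊆⊥⇒¬Connected (two-sided-connected π comp)) rhs)
    where
    lhs : total (λ S → within G U S + (below P S + below Q S)) w
          ≡ total (within G U) w + (total (below P) w + total (below Q) w)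
    lhs = trans (total-+ (within G U) (λ S → below P S + below Q S) w)
                (cong (total (within G U) w +_) (total-+ (below P) (below Q) w))
    rhs : total (λ S → below U S + (within G P S + within G Q S + below ⊥ S)) w
          ≡ total (below U) w + (total (within G P) w + total (within G Q) w + total (below {n} ⊥) w)
    rhs = trans (total-+ (below U) (λ S → within G P S + within G Q S + below ⊥ S) w)
      (cong (total (below U) w +_) (trans (total-+ (λ S → within G P S + within G Q S) (below ⊥) w)
        (cong (_+ total (below {n} ⊥) w) (total-+ (within G P) (within G Q) w))))

  total-leaf : ∀ {U v} → U ≡ ⁅ v ⁆ → ∀ w →
               total (within G U) w + total (below {n} ⊥) w ≡ total (below U) w
  total-leaf {U} {v} refl w = trans (sym (total-+ (within G ⁅ v ⁆) (below ⊥) w))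
    (total-cong (λ S → within G ⁅ v ⁆ S + below ⊥ S) (below ⁅ v ⁆) w λ S →
      leaf-indicators (S ⊆? ⁅ v ⁆) (S ⊆? ⊥) (connected? G S)
        (λ S⊆⊥ {x} x∈S → contradiction (S⊆⊥ x∈S) ∉⊥) ⊆⊥⇒¬Connected (single S))
    where
    single : ∀ S → S ⊆ ⁅ v ⁆ → ¬ (S ⊆ ⊥) → ConnectedOn S
    single S S⊆v S⊈⊥ with nonempty? S
    ... | no empty = contradiction (λ {x} x∈S → contradiction (x , x∈S) empty) S⊈⊥
    ... | yes (x , x∈S) with refl ← x∈⁅y⁆⇒x≡y v (S⊆v x∈S) =
      subst ConnectedOn
        (⊆-antisym (λ y∈v → subst (_∈ S) (sym (x∈⁅y⁆⇒x≡y v y∈v)) x∈S) S⊆v)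
        (singleton-connected G v)

  count-⊥ : total (below {n} ⊥) one ≡ 1
  count-⊥ = trans (count-below {n} ⊥) (cong (2 ^_) (∣⊥∣≡0 n))

  2size-⊥ : 2 * total (below {n} ⊥) id ≡ 0
  2size-⊥ = trans (2size-below {n} ⊥) (cong (λ k → k * 2 ^ k) (∣⊥∣≡0 n))

-- The gap inequality at the root of a cotree

gap-both-sides≥2 : ∀ {s t m} → 2 ≤ℕ s → 2 ≤ℕ t → 6 ≤ℕ m → s + t ≡ suc m →
  ∀ D → D + mixed s t ≡ suc m * m + mixedExcess s t →
  m * m * (suc m + mixed s t) < D * (2 ^ m + m)
gap-both-sides≥2 {s} {t} {m} 2≤s 2≤t 6≤m s+t≡1+m D
  with i , refl ← ℕ.m≤n⇒∃[o]m+o≡n 2≤s | j , refl ← ℕ.m≤n⇒∃[o]m+o≡n 2≤t =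
  subst (λ m → 6 ≤ℕ m → D + mixed s t ≡ suc m * m + mixedExcess s t →
               m * m * (suc m + mixed s t) < D * (2 ^ m + m))
        (ℕ.suc-injective (trans (size i j) s+t≡1+m)) (gap-no-universal i j D) 6≤m
  where
  size : ∀ i j → 4 + i + j ≡ 2 + i + (2 + j)
  size = solve-∀

module _ {s t m} (2≤s : 2 ≤ℕ s) (2≤t : 2 ≤ℕ t) (6≤m : 6 ≤ℕ m) (s+t≡1+m : s + t ≡ suc m) where

  private
    κ = 2 ^ m + m

  -- The reference case is `K s t`, where `e₁` and `e₂` vanish. Each connected set of size at least
  -- 2 inside a part adds 1 to the count and, as the other part has order at least 2, at least 1 to
  -- `D`. Because `m * m ≤ κ`, the gain on the right covers the cost on the left.
  gap-join : ∀ D e₁ e₂ X₁ X₂ →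
    D + (e₁ + e₂ + mixed s t) ≡ suc m * m + (X₁ + X₂ + (t * e₁ + s * e₂) + mixedExcess s t) →
    m * m * (suc m + (e₁ + e₂ + mixed s t)) < D * κ
  gap-join D e₁ e₂ X₁ X₂ eq = begin-strict
    m * m * (suc m + (e₁ + e₂ + mixed s t))             ≡⟨ expand (m * m) (suc m) (e₁ + e₂) (mixed s t) ⟩
    m * m * (suc m + mixed s t) + m * m * (e₁ + e₂)     <⟨ ℕ.+-mono-<-≤ (gap-both-sides≥2 2≤s 2≤t 6≤m s+t≡1+m D₀ D₀-eq)
                                                              (ℕ.*-monoˡ-≤ (e₁ + e₂) (m²≤κ 6≤m)) ⟩
    D₀ * κ + κ * (e₁ + e₂)                              ≡⟨ factor D₀ κ (e₁ + e₂) ⟩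
    (D₀ + (e₁ + e₂)) * κ                                ≤⟨ ℕ.*-monoˡ-≤ κ D₀≤D ⟩
    D * κ                                               ∎
    where
    open ℕ.≤-Reasoning
    expand : ∀ x n e f → x * (n + (e + f)) ≡ x * (n + f) + x * e
    expand = solve-∀
    factor : ∀ d k e → d * k + k * e ≡ (d + e) * k
    factor = solve-∀

    -- The deficiency of `K s t` itself; the truncated subtraction is exact by `D₀-eq`.
    D₀ = suc m * m + mixedExcess s t ∸ mixed s t

    D₀-eq : D₀ + mixed s t ≡ suc m * m + mixedExcess s t
    D₀-eq = ℕ.m∸n+n≡m (begin
      mixed s t                     ≤⟨ ℕ.<⇒≤ (mixed<mixedExcess+size
                                          (ℕ.<-≤-trans (s≤s z≤n) 2≤s) (ℕ.<-≤-trans (s≤s z≤n) 2≤t)) ⟩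
      mixedExcess s t + (s + t)     ≡⟨ cong (mixedExcess s t +_) s+t≡1+m ⟩
      mixedExcess s t + suc m       ≤⟨ ℕ.+-monoʳ-≤ _ (ℕ.m≤m*n (suc m) m {{>-nonZero (ℕ.<-≤-trans (s≤s z≤n) 6≤m)}}) ⟩
      mixedExcess s t + suc m * m   ≡⟨ ℕ.+-comm (mixedExcess s t) _ ⟩
      suc m * m + mixedExcess s t   ∎)

    D₀≤D : D₀ + (e₁ + e₂) ≤ℕ D
    D₀≤D = ℕ.+-cancelʳ-≤ (e₁ + e₂ + mixed s t) _ _ (begin
      D₀ + (e₁ + e₂) + (e₁ + e₂ + mixed s t)
        ≡⟨ regroup D₀ e₁ e₂ (mixed s t) ⟩
      D₀ + mixed s t + (2 * e₁ + 2 * e₂)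
        ≡⟨ cong (_+ (2 * e₁ + 2 * e₂)) D₀-eq ⟩
      suc m * m + mixedExcess s t + (2 * e₁ + 2 * e₂)
        ≤⟨ ℕ.+-monoʳ-≤ (suc m * m + mixedExcess s t)
             (ℕ.+-mono-≤ (ℕ.*-monoˡ-≤ e₁ 2≤t) (ℕ.*-monoˡ-≤ e₂ 2≤s)) ⟩
      suc m * m + mixedExcess s t + (t * e₁ + s * e₂)
        ≤⟨ ℕ.m≤m+n _ (X₁ + X₂) ⟩
      suc m * m + mixedExcess s t + (t * e₁ + s * e₂) + (X₁ + X₂)
        ≡⟨ collect (suc m * m) (mixedExcess s t) (t * e₁ + s * e₂) (X₁ + X₂) ⟩
      suc m * m + (X₁ + X₂ + (t * e₁ + s * e₂) + mixedExcess s t)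
        ≡⟨ eq ⟨
      D + (e₁ + e₂ + mixed s t) ∎)
      where
      regroup : ∀ d x y z → d + (x + y) + (x + y + z) ≡ d + z + (2 * x + 2 * y)
      regroup = solve-∀
      collect : ∀ x y z w → x + y + z + w ≡ x + (w + z + y)
      collect = solve-∀

module _ {m} (D e X : ℕ)
         -- The zeros are the `extra` and `excess` of a one-vertex part: this is the equation of
         -- `deficiency` at a join whose first part is the leaf `c`.
         (eq : D + (0 + e + mixed 1 m) ≡ suc m * m + (0 + X + (m * 0 + 1 * e) + mixedExcess 1 m)) where

  private
    κ = 2 ^ m + m

    D≡ : D ≡ m * m + X
    D≡ = ℕ.+-cancelʳ-≡ (e + mixed 1 m) D (m * m + X) (trans eq (regroup (big m) m e X))
      where
      regroup : ∀ b m e X → (1 + m) * m + (0 + X + (m * 0 + 1 * e) + (2 * (0 * b) + 1 * b + m * 0))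
                            ≡ m * m + X + (e + (0 + 1) * (b + m))
      regroup = solve-∀

    N≡ : suc m + (0 + e + mixed 1 m) ≡ κ + e
    N≡ = trans (regroup (big m) m e) (cong (λ k → k + m + e) (sym (2^≡big m)))
      where
      regroup : ∀ b m e → 1 + m + (0 + e + (0 + 1) * (b + m)) ≡ b + m + 1 + m + e
      regroup = solve-∀

  gap-star : e ≡ 0 → X ≡ 0 → m * m * (suc m + (0 + e + mixed 1 m)) ≡ D * κ
  gap-star refl refl = trans (cong (m * m *_) N≡)
    (cong₂ _*_ (trans (sym (ℕ.+-identityʳ (m * m))) (sym D≡)) (ℕ.+-identityʳ κ))

  gap-universal : 6 ≤ℕ m → 2 * e < 3 * X → m * m * (suc m + (0 + e + mixed 1 m)) < D * κ
  gap-universal 6≤m 2e<3X = begin-strict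
    m * m * (suc m + (0 + e + mixed 1 m)) ≡⟨ cong (m * m *_) N≡ ⟩
    m * m * (κ + e)                       ≡⟨ ℕ.*-distribˡ-+ (m * m) κ e ⟩
    m * m * κ + m * m * e                 <⟨ ℕ.+-monoʳ-< (m * m * κ) (ℕ.*-cancelˡ-< 3 _ _ tripled) ⟩
    m * m * κ + X * κ                     ≡⟨ ℕ.*-distribʳ-+ κ (m * m) X ⟨
    (m * m + X) * κ                       ≡⟨ cong (_* κ) D≡ ⟨
    D * κ                                 ∎
    where
    open ℕ.≤-Reasoning
    instance
      κ≢0 = >-nonZero (ℕ.<-≤-trans (ℕ.m^n>0 2 m) (ℕ.m≤m+n (2 ^ m) m))
    tripled : 3 * (m * m * e) < 3 * (X * κ)
    tripled = begin-strict
      3 * (m * m * e)   ≡⟨ ℕ.*-assoc 3 (m * m) e ⟨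
      3 * (m * m) * e   ≤⟨ ℕ.*-monoˡ-≤ e (3m²≤2κ 6≤m) ⟩
      2 * κ * e         ≡⟨ swapped κ e ⟩
      2 * e * κ         <⟨ ℕ.*-monoˡ-< κ 2e<3X ⟩
      3 * X * κ         ≡⟨ ℕ.*-assoc 3 X κ ⟩
      3 * (X * κ)       ∎
      where
      swapped : ∀ k e → 2 * k * e ≡ 2 * e * k
      swapped = solve-∀

-- Number and total size of the connected sets, read off the cotree

module _ {n} {G : Graph (Fin n)} where

  private
    N T : Subset n → ℕ
    N U = total (within G U) one
    T U = total (within G U) id

  size>0 : ∀ {U} → Cotree G U → 0 < ∣ U ∣
  size>0 (leaf v refl)   = Nonempty⇒0<∣∣ (v , x∈⁅x⁆ v)
  size>0 (union π _ _ _) = Nonempty⇒0<∣∣ (_ , left π (proj₂ (leftNonempty π)))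
  size>0 (join π _ _ _)  = Nonempty⇒0<∣∣ (_ , left π (proj₂ (leftNonempty π)))

  -- The single vertices account for `∣ U ∣`. At a join the new sets number 2^(s+t) - 2^s - 2^t + 1,
  -- which factors as `mixed s t`; adding `2 ^ s + 2 ^ t` to both sides keeps the computation in the
  -- naturals.
  count-cotree : ∀ {U} (t : Cotree G U) → N U ≡ ∣ U ∣ + extra G t
  count-cotree {U} (leaf v refl) = ℕ.+-cancelʳ-≡ 1 (N ⁅ v ⁆) _ (begin
    N ⁅ v ⁆ + 1                     ≡⟨ cong (N ⁅ v ⁆ +_) (count-⊥ G) ⟨
    N ⁅ v ⁆ + total (below {n} ⊥) one ≡⟨ total-leaf G {v = v} refl one ⟩
    total (below ⁅ v ⁆) one         ≡⟨ count-below ⁅ v ⁆ ⟩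
    2 ^ ∣ ⁅ v ⁆ ∣                   ≡⟨ cong (2 ^_) (∣⁅x⁆∣≡1 v) ⟩
    1 + 0 + 1                       ≡⟨ cong (λ k → k + 0 + 1) (∣⁅x⁆∣≡1 v) ⟨
    ∣ ⁅ v ⁆ ∣ + 0 + 1               ∎)
    where open ≡-Reasoning
  count-cotree {U} (union {P} {Q} π anti p q) = begin
    N U                                             ≡⟨ total-union G π anti one ⟩
    N P + N Q                                       ≡⟨ cong₂ _+_ (count-cotree p) (count-cotree q) ⟩
    (∣ P ∣ + extra G p) + (∣ Q ∣ + extra G q)       ≡⟨ interchange ∣ P ∣ ∣ Q ∣ (extra G p) (extra G q) ⟩
    (∣ P ∣ + ∣ Q ∣) + (extra G p + extra G q)       ≡⟨ cong (_+ (extra G p + extra G q)) (∣partition∣ π) ⟨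
    ∣ U ∣ + (extra G p + extra G q)                 ∎
    where
    open ≡-Reasoning
    interchange : ∀ s t e f → (s + e) + (t + f) ≡ (s + t) + (e + f)
    interchange = solve-∀
  count-cotree {U} (join {P} {Q} π comp p q) = ℕ.+-cancelʳ-≡ (2 ^ s + 2 ^ t) (N U) _ (begin
    N U + (2 ^ s + 2 ^ t)
      ≡⟨ cong₂ (λ x y → N U + (x + y)) (count-below P) (count-below Q) ⟨
    N U + (total (below P) one + total (below Q) one)
      ≡⟨ total-join G π comp one ⟩
    total (below U) one + (N P + N Q + total (below {n} ⊥) one)
      ≡⟨ cong₂ _+_ (trans (count-below U) (trans (cong (2 ^_) (∣partition∣ π)) (ℕ.^-distribˡ-+-* 2 s t)))
           (cong₂ _+_ (cong₂ _+_ (count-cotree p) (count-cotree q)) (count-⊥ G)) ⟩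
    2 ^ s * 2 ^ t + (s + e + (t + f) + 1)
      ≡⟨ cong₂ (λ x y → x * y + (s + e + (t + f) + 1)) (2^≡big s) (2^≡big t) ⟩
    (big s + s + 1) * (big t + t + 1) + (s + e + (t + f) + 1)
      ≡⟨ regroup (big s) (big t) s t e f ⟩
    s + t + (e + f + mixed s t) + (big s + s + 1 + (big t + t + 1))
      ≡⟨ cong₂ (λ x y → x + (e + f + mixed s t) + y) (∣partition∣ π)
               (cong₂ _+_ (2^≡big s) (2^≡big t)) ⟨
    ∣ U ∣ + (e + f + mixed s t) + (2 ^ s + 2 ^ t) ∎)
    where
    open ≡-Reasoning
    s = ∣ P ∣
    t = ∣ Q ∣
    e = extra G p
    f = extra G q
    regroup : ∀ a b s t e f → (a + s + 1) * (b + t + 1) + (s + e + (t + f) + 1)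
              ≡ s + t + (e + f + (a + s) * (b + t)) + (a + s + 1 + (b + t + 1))
    regroup = solve-∀

  -- This identifies `excess` with the sum of `∣ U ∣ + 2 - 2 * ∣ S ∣`, the term `2 * ∣ U ∣` coming
  -- from the single vertices. Passing from `P` to `U` raises the weight of every set inside `P` by
  -- `∣ Q ∣`, which explains the cross terms of `excess`.
  2size-cotree : ∀ {U} (t : Cotree G U) →
                 2 * T U + excess G t ≡ 2 * ∣ U ∣ + (∣ U ∣ + 2) * extra G t
  2size-cotree (leaf v refl) = begin
    2 * T ⁅ v ⁆ + 0
      ≡⟨ cong (2 * T ⁅ v ⁆ +_) (2size-⊥ G) ⟨
    2 * T ⁅ v ⁆ + 2 * total (below {n} ⊥) id
      ≡⟨ ℕ.*-distribˡ-+ 2 (T ⁅ v ⁆) _ ⟨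
    2 * (T ⁅ v ⁆ + total (below {n} ⊥) id)
      ≡⟨ cong (2 *_) (total-leaf G {v = v} refl id) ⟩
    2 * total (below ⁅ v ⁆) id
      ≡⟨ 2size-below ⁅ v ⁆ ⟩
    ∣ ⁅ v ⁆ ∣ * 2 ^ ∣ ⁅ v ⁆ ∣
      ≡⟨ cong (λ k → k * 2 ^ k) (∣⁅x⁆∣≡1 v) ⟩
    2 * 1 + (1 + 2) * 0
      ≡⟨ cong (λ k → 2 * k + (k + 2) * 0) (∣⁅x⁆∣≡1 v) ⟨
    2 * ∣ ⁅ v ⁆ ∣ + (∣ ⁅ v ⁆ ∣ + 2) * 0 ∎
    where open ≡-Reasoning
  2size-cotree {U} (union {P} {Q} π anti p q) = begin
    2 * T U + (X + Y + (t * e + s * f))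
      ≡⟨ cong (λ x → 2 * x + (X + Y + (t * e + s * f))) (total-union G π anti id) ⟩
    2 * (T P + T Q) + (X + Y + (t * e + s * f))
      ≡⟨ regroup (T P) (T Q) X Y (t * e + s * f) ⟩
    (2 * T P + X) + (2 * T Q + Y) + (t * e + s * f)
      ≡⟨ cong₂ (λ x y → x + y + (t * e + s * f)) (2size-cotree p) (2size-cotree q) ⟩
    (2 * s + (s + 2) * e) + (2 * t + (t + 2) * f) + (t * e + s * f)
      ≡⟨ collect s t e f ⟩
    2 * (s + t) + (s + t + 2) * (e + f)
      ≡⟨ cong (λ k → 2 * k + (k + 2) * (e + f)) (∣partition∣ π) ⟨
    2 * ∣ U ∣ + (∣ U ∣ + 2) * (e + f) ∎
    where
    open ≡-Reasoning
    s = ∣ P ∣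
    t = ∣ Q ∣
    e = extra G p
    f = extra G q
    X = excess G p
    Y = excess G q
    regroup : ∀ a b x y z → 2 * (a + b) + (x + y + z) ≡ (2 * a + x) + (2 * b + y) + z
    regroup = solve-∀
    collect : ∀ s t e f → (2 * s + (s + 2) * e) + (2 * t + (t + 2) * f) + (t * e + s * f)
                          ≡ 2 * (s + t) + (s + t + 2) * (e + f)
    collect = solve-∀
  2size-cotree {U} (join {P} {Q} π comp p q) = ℕ.+-cancelʳ-≡ (s * 2 ^ s + t * 2 ^ t) _ _ (begin
    2 * T U + Z + (s * 2 ^ s + t * 2 ^ t)
      ≡⟨ cong₂ (λ x y → 2 * T U + Z + (x + y)) (2size-below P) (2size-below Q) ⟨
    2 * T U + Z + (2 * total (below P) id + 2 * total (below Q) id)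
      ≡⟨ gather (T U) Z (total (below P) id) (total (below Q) id) ⟩
    2 * (T U + (total (below P) id + total (below Q) id)) + Z
      ≡⟨ cong (λ x → 2 * x + Z) (total-join G π comp id) ⟩
    2 * (total (below U) id + (T P + T Q + total (below {n} ⊥) id)) + Z
      ≡⟨ regroup (total (below U) id) (T P) (T Q) (total (below {n} ⊥) id) X Y
                 (t * e + s * f) (mixedExcess s t) ⟩
    2 * total (below U) id + ((2 * T P + X) + (2 * T Q + Y) + 2 * total (below {n} ⊥) id)
      + (t * e + s * f + mixedExcess s t)
      ≡⟨ cong₂ (λ x y → x + y + (t * e + s * f + mixedExcess s t))
           (trans (2size-below U) (cong (λ k → k * 2 ^ k) (∣partition∣ π)))
           (cong₂ _+_ (cong₂ _+_ (2size-cotree p) (2size-cotree q)) (2size-⊥ G)) ⟩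
    (s + t) * 2 ^ (s + t) + ((2 * s + (s + 2) * e) + (2 * t + (t + 2) * f) + 0)
      + (t * e + s * f + mixedExcess s t)
      ≡⟨ cong (λ x → (s + t) * x + ((2 * s + (s + 2) * e) + (2 * t + (t + 2) * f) + 0)
                       + (t * e + s * f + mixedExcess s t))
           (trans (ℕ.^-distribˡ-+-* 2 s t) (cong₂ _*_ (2^≡big s) (2^≡big t))) ⟩
    (s + t) * ((big s + s + 1) * (big t + t + 1)) + ((2 * s + (s + 2) * e) + (2 * t + (t + 2) * f) + 0)
      + (t * e + s * f + mixedExcess s t)
      ≡⟨ collect (big s) (big t) s t e f ⟩
    2 * (s + t) + (s + t + 2) * (e + f + mixed s t) + (s * (big s + s + 1) + t * (big t + t + 1))
      ≡⟨ cong₂ (λ k x → 2 * k + (k + 2) * (e + f + mixed s t) + x) (∣partition∣ π)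
           (cong₂ (λ x y → s * x + t * y) (2^≡big s) (2^≡big t)) ⟨
    2 * ∣ U ∣ + (∣ U ∣ + 2) * (e + f + mixed s t) + (s * 2 ^ s + t * 2 ^ t) ∎)
    where
    open ≡-Reasoning
    s = ∣ P ∣
    t = ∣ Q ∣
    e = extra G p
    f = extra G q
    X = excess G p
    Y = excess G q
    Z = X + Y + (t * e + s * f) + mixedExcess s t
    gather : ∀ u z x y → 2 * u + z + (2 * x + 2 * y) ≡ 2 * (u + (x + y)) + z
    gather = solve-∀
    regroup : ∀ u a b o x y v w → 2 * (u + (a + b + o)) + (x + y + v + w)
              ≡ 2 * u + ((2 * a + x) + (2 * b + y) + 2 * o) + (v + w)
    regroup = solve-∀
    collect : ∀ a b s t e f →
      (s + t) * ((a + s + 1) * (b + t + 1)) + ((2 * s + (s + 2) * e) + (2 * t + (t + 2) * f) + 0)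
        + (t * e + s * f + (2 * (a * b) + s * b + t * a))
      ≡ 2 * (s + t) + (s + t + 2) * (e + f + (a + s) * (b + t)) + (s * (a + s + 1) + t * (b + t + 1))
    collect = solve-∀

-- Stars are extremal

module _ {n} {G : Graph (Fin n)} where

  private
    N T : Subset n → ℕ
    N U = total (within G U) one
    T U = total (within G U) id

    ≤-weighted : ∀ {s t} e f → 0 < s → 0 < t → e + f ≤ℕ t * e + s * f
    ≤-weighted {s} {t} e f 0<s 0<t =
      ℕ.+-mono-≤ (ℕ.m≤n*m e t {{>-nonZero 0<t}}) (ℕ.m≤n*m f s {{>-nonZero 0<s}})

    ≤-weighted-extra : ∀ {P Q} (p : Cotree G P) (q : Cotree G Q) X →
      extra G p + extra G q ≤ℕ X + (∣ Q ∣ * extra G p + ∣ P ∣ * extra G q)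
    ≤-weighted-extra p q X =
      ℕ.≤-trans (≤-weighted (extra G p) (extra G q) (size>0 p) (size>0 q)) (ℕ.m≤n+m _ X)

  -- No induction is required: the cross terms of `excess` alone outweigh the extra sets inside the
  -- two parts, so only the sets created at the root have to be compared.
  extra<excess+size : ∀ {U} (t : Cotree G U) → extra G t < excess G t + ∣ U ∣
  extra<excess+size t@(leaf _ _) = size>0 t
  extra<excess+size t@(union π anti p q) =
    ℕ.≤-<-trans (≤-weighted-extra p q (excess G p + excess G q)) (ℕ.m<m+n _ (size>0 t))
  extra<excess+size {U} (join {P} {Q} π comp p q) = begin-strict
    e + mixed s t
      <⟨ ℕ.+-mono-≤-< (≤-weighted-extra p q (excess G p + excess G q))
                      (mixed<mixedExcess+size (size>0 p) (size>0 q)) ⟩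
    X + (mixedExcess s t + (s + t))
      ≡⟨ ℕ.+-assoc X (mixedExcess s t) (s + t) ⟨
    X + mixedExcess s t + (s + t)
      ≡⟨ cong (X + mixedExcess s t +_) (∣partition∣ π) ⟨
    X + mixedExcess s t + ∣ U ∣ ∎
    where
    open ℕ.≤-Reasoning
    s = ∣ P ∣
    t = ∣ Q ∣
    e = extra G p + extra G q
    X = excess G p + excess G q + (t * extra G p + s * extra G q)

  private
    2e<3e′ : ∀ {e e′} → e ≤ℕ e′ → e ≡ 0 ⊎ 2 * e < 3 * e′
    2e<3e′ {zero}  _    = inj₁ refl
    2e<3e′ {suc e} e≤e′ = inj₂ (ℕ.<-≤-trans (ℕ.*-monoˡ-< (suc e) (ℕ.n<1+n 2)) (ℕ.*-monoʳ-≤ 3 e≤e′))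

  -- Again the root decides. At a union the cross terms give `extra ≤ excess`, which is strict
  -- enough after scaling unless `extra` is zero; at a join the numeric bound on `mixed` supplies
  -- strictness.
  no-extra-or-2extra<3excess : ∀ {U} (t : Cotree G U) → 6 ≤ℕ ∣ U ∣ →
                               extra G t ≡ 0 ⊎ 2 * extra G t < 3 * excess G t
  no-extra-or-2extra<3excess (leaf _ _) _ = inj₁ refl
  no-extra-or-2extra<3excess (union π anti p q) _ =
    2e<3e′ (≤-weighted-extra p q (excess G p + excess G q))
  no-extra-or-2extra<3excess {U} (join {P} {Q} π comp p q) 6≤∣U∣ = inj₂ (begin-strict
    2 * (e + mixed s t)               ≡⟨ ℕ.*-distribˡ-+ 2 e (mixed s t) ⟩
    2 * e + 2 * mixed s t
      <⟨ ℕ.+-mono-≤-< (ℕ.*-mono-≤ (ℕ.n≤1+n 2) (≤-weighted-extra p q (excess G p + excess G q)))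
           (2mixed<3mixedExcess s t (size>0 p) (size>0 q) (subst (6 ≤ℕ_) (∣partition∣ π) 6≤∣U∣)) ⟩
    3 * X + 3 * mixedExcess s t       ≡⟨ ℕ.*-distribˡ-+ 3 X (mixedExcess s t) ⟨
    3 * (X + mixedExcess s t)         ∎)
    where
    open ℕ.≤-Reasoning
    s = ∣ P ∣
    t = ∣ Q ∣
    e = extra G p + extra G q
    X = excess G p + excess G q + (t * extra G p + s * extra G q)

  private
    0<mixed : ∀ {s t} → 0 < s → 0 < t → 0 < mixed s t
    0<mixed {s} {t} 0<s 0<t =
      ℕ.*-mono-≤ (ℕ.≤-trans 0<s (ℕ.m≤n+m s (big s))) (ℕ.≤-trans 0<t (ℕ.m≤n+m t (big t)))

    some-extra : ∀ {U P Q} (π : Partition U P Q) (comp : Complete G P Q)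
                 (p : Cotree G P) (q : Cotree G Q) → extra G (join π comp p q) ≢ 0
    some-extra π comp p q eq = ℕ.<⇒≢ (0<mixed (size>0 p) (size>0 q))
      (sym (ℕ.m+n≡0⇒n≡0 (extra G p + extra G q) eq))

  no-extra⇒no-excess : ∀ {U} (t : Cotree G U) → extra G t ≡ 0 → excess G t ≡ 0
  no-extra⇒no-excess (leaf _ _) _ = refl
  no-extra⇒no-excess (union {P} {Q} π anti p q) eq
    with extra G p | extra G q | no-extra⇒no-excess p | no-extra⇒no-excess q
  ... | zero | zero | ihp | ihq = cong₂ _+_ (cong₂ _+_ (ihp refl) (ihq refl))
                                            (cong₂ _+_ (ℕ.*-zeroʳ ∣ Q ∣) (ℕ.*-zeroʳ ∣ P ∣))
  no-extra⇒no-excess (join π comp p q) eq = contradiction eq (some-extra π comp p q)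

  no-extra⇒anticomplete : ∀ {U} (t : Cotree G U) → extra G t ≡ 0 → Anticomplete G U U
  no-extra⇒anticomplete (leaf v refl) _ x∈ y∈ xy with refl ← x∈⁅y⁆⇒x≡y v x∈ | refl ← x∈⁅y⁆⇒x≡y v y∈ =
    adj-irrefl G refl xy
  no-extra⇒anticomplete (union π anti p q) eq x∈ y∈ xy with cover π x∈ | cover π y∈
  ... | inj₁ x∈P | inj₁ y∈P = no-extra⇒anticomplete p (ℕ.m+n≡0⇒m≡0 (extra G p) eq) x∈P y∈P xy
  ... | inj₁ x∈P | inj₂ y∈Q = anti x∈P y∈Q xy
  ... | inj₂ x∈Q | inj₁ y∈P = anti y∈P x∈Q (adj-sym G xy)
  ... | inj₂ x∈Q | inj₂ y∈Q = no-extra⇒anticomplete q (ℕ.m+n≡0⇒n≡0 (extra G p) eq) x∈Q y∈Q xy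
  no-extra⇒anticomplete (join π comp p q) eq = contradiction eq (some-extra π comp p q)

  anticomplete⇒no-extra : ∀ {U} (t : Cotree G U) → Anticomplete G U U → extra G t ≡ 0
  anticomplete⇒no-extra (leaf _ _) _ = refl
  anticomplete⇒no-extra (union π _ p q) anti = cong₂ _+_
    (anticomplete⇒no-extra p (λ x∈P y∈P → anti (left π x∈P) (left π y∈P)))
    (anticomplete⇒no-extra q (λ x∈Q y∈Q → anti (right π x∈Q) (right π y∈Q)))
  anticomplete⇒no-extra (join π comp _ _) anti =
    let x , x∈P = leftNonempty π; y , y∈Q = rightNonempty π in
    contradiction (comp x∈P y∈Q) (anti (left π x∈P) (right π y∈Q))

  -- Substituting N = n + e and 2 T = 2 n + (n + 2) e - X into D = (n + 1) N - 2 T leaves D = n (n -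
  -- 1) + X - e.
  deficiency : ∀ {U} (t : Cotree G U) {m} D → ∣ U ∣ ≡ suc m →
               (suc m + 1) * N U ≡ 2 * T U + D →
               D + extra G t ≡ suc m * m + excess G t
  deficiency {U} t {m} D size eq = ℕ.+-cancelʳ-≡ (2 * suc m + (suc m + 2) * e) _ _ (begin
    D + e + (2 * suc m + (suc m + 2) * e)
      ≡⟨ cong (λ k → D + e + (2 * k + (k + 2) * e)) size ⟨
    D + e + (2 * ∣ U ∣ + (∣ U ∣ + 2) * e)
      ≡⟨ cong (D + e +_) (2size-cotree t) ⟨
    D + e + (2 * T U + X)
      ≡⟨ regroup D e (T U) X ⟩
    2 * T U + D + (e + X)
      ≡⟨ cong (_+ (e + X)) eq ⟨
    (suc m + 1) * N U + (e + X)
      ≡⟨ cong (λ k → (suc m + 1) * k + (e + X)) (trans (count-cotree t) (cong (_+ e) size)) ⟩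
    (suc m + 1) * (suc m + e) + (e + X)
      ≡⟨ collect m e X ⟩
    suc m * m + X + (2 * suc m + (suc m + 2) * e) ∎)
    where
    open ≡-Reasoning
    e = extra G t
    X = excess G t
    regroup : ∀ d e u x → d + e + (2 * u + x) ≡ 2 * u + d + (e + x)
    regroup = solve-∀
    collect : ∀ m e x → (1 + m + 1) * (1 + m + e) + (e + x)
              ≡ (1 + m) * m + x + (2 * (1 + m) + (1 + m + 2) * e)
    collect = solve-∀

  -- The slack in `extra<excess+size` is `o = X + m - e`, and then (m + 1) m + X - e = m² + o. This
  -- is the witness, and it shows at once that (n + 1) N - 2 T is a natural number and at least m².
  ∃deficiency : ∀ {U} (t : Cotree G U) {m} → ∣ U ∣ ≡ suc m →
                ∃ λ D → (suc m + 1) * N U ≡ 2 * T U + D × m * m ≤ℕ D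
  ∃deficiency {U} t {m} size
    with o , e+o≡ ← ℕ.m≤n⇒∃[o]m+o≡n (ℕ.≤-pred (subst (λ k → extra G t < k)
           (trans (cong (excess G t +_) size) (ℕ.+-suc (excess G t) m)) (extra<excess+size t)))
    = m * m + o , ℕ.+-cancelʳ-≡ X _ _ (begin
      (suc m + 1) * N U + X
        ≡⟨ cong (λ k → (suc m + 1) * k + X) (trans (count-cotree t) (cong (_+ e) size)) ⟩
      (suc m + 1) * (suc m + e) + X
        ≡⟨ regroup m e X ⟩
      2 * suc m + (suc m + 1) * e + m * m + (X + m)
        ≡⟨ cong (2 * suc m + (suc m + 1) * e + m * m +_) e+o≡ ⟨
      2 * suc m + (suc m + 1) * e + m * m + (e + o)
        ≡⟨ collect m e o ⟩
      2 * suc m + (suc m + 2) * e + (m * m + o)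
        ≡⟨ cong (λ k → 2 * k + (k + 2) * e + (m * m + o)) size ⟨
      2 * ∣ U ∣ + (∣ U ∣ + 2) * e + (m * m + o)
        ≡⟨ cong (_+ (m * m + o)) (2size-cotree t) ⟨
      2 * T U + X + (m * m + o)
        ≡⟨ exchange (2 * T U) X (m * m + o) ⟩
      2 * T U + (m * m + o) + X ∎) , ℕ.m≤m+n (m * m) o
    where
    open ≡-Reasoning
    e = extra G t
    X = excess G t
    regroup : ∀ m e x → (1 + m + 1) * (1 + m + e) + x ≡ 2 * (1 + m) + (1 + m + 1) * e + m * m + (x + m)
    regroup = solve-∀
    collect : ∀ m e o → 2 * (1 + m) + (1 + m + 1) * e + m * m + (e + o)
                        ≡ 2 * (1 + m) + (1 + m + 2) * e + (m * m + o)
    collect = solve-∀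
    exchange : ∀ x y z → x + y + z ≡ x + z + y
    exchange = solve-∀

  -- `extra G q ≡ 0` expresses that `Q` is independent, in the form in which it enters the counts.
  data Star-centred (U : Subset n) : Set where
    star : ∀ {Q} c → Partition U ⁅ c ⁆ Q → Complete G ⁅ c ⁆ Q →
           (q : Cotree G Q) → extra G q ≡ 0 → Star-centred U

  private
    rest-size : ∀ {U : Subset n} {c Q m} → Partition U ⁅ c ⁆ Q → ∣ U ∣ ≡ suc m → ∣ Q ∣ ≡ m
    rest-size {c = c} {Q} π size = ℕ.suc-injective
      (trans (cong (_+ ∣ Q ∣) (sym (∣⁅x⁆∣≡1 c))) (trans (sym (∣partition∣ π)) size))

    centred-deficiency : ∀ {U c Q m} (π : Partition U ⁅ c ⁆ Q) (comp : Complete G ⁅ c ⁆ Q)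
      (q : Cotree G Q) D → ∣ U ∣ ≡ suc m → (suc m + 1) * N U ≡ 2 * T U + D →
      D + (0 + extra G q + mixed 1 m)
      ≡ suc m * m + (0 + excess G q + (m * 0 + 1 * extra G q) + mixedExcess 1 m)
    centred-deficiency {c = c} {Q} {m} π comp q D size eq =
      subst₂ (λ s t → D + (0 + extra G q + mixed s t)
                ≡ suc m * m + (0 + excess G q + (t * 0 + s * extra G q) + mixedExcess s t))
        (∣⁅x⁆∣≡1 c) (rest-size π size)
        (deficiency (join π comp (leaf c refl) q) D size eq)

    centred-count : ∀ {U c Q m} (π : Partition U ⁅ c ⁆ Q) (comp : Complete G ⁅ c ⁆ Q)
      (q : Cotree G Q) → ∣ U ∣ ≡ suc m → N U ≡ suc m + (0 + extra G q + mixed 1 m)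
    centred-count {U} {c} {Q} {m} π comp q size = trans
      (count-cotree (join π comp (leaf c refl) q))
      (cong₂ _+_ size (cong₂ (λ s t → 0 + extra G q + mixed s t) (∣⁅x⁆∣≡1 c) (rest-size π size)))

  star-gap : ∀ {U m} D → Star-centred U → ∣ U ∣ ≡ suc m → (suc m + 1) * N U ≡ 2 * T U + D →
             m * m * N U ≡ D * (2 ^ m + m)
  star-gap {U} {m} D (star c π comp q no-extra) size eq = trans
    (cong (m * m *_) (centred-count π comp q size))
    (gap-star {m} D (extra G q) (excess G q) (centred-deficiency π comp q D size eq)
      no-extra (no-extra⇒no-excess q no-extra))

  private
    Gap : Subset n → ℕ → ℕ → Set
    Gap U m D = Star-centred U ⊎ m * m * N U < D * (2 ^ m + m)

    universal-gap : ∀ {U c Q m} → Partition U ⁅ c ⁆ Q → Complete G ⁅ c ⁆ Q → Cotree G Q →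
      ∀ D → ∣ U ∣ ≡ suc m → 6 ≤ℕ m → (suc m + 1) * N U ≡ 2 * T U + D → Gap U m D
    universal-gap {U} {c} {Q} {m} π comp q D size 6≤m eq
      with no-extra-or-2extra<3excess q (subst (6 ≤ℕ_) (sym (rest-size π size)) 6≤m)
    ... | inj₁ no-extra = inj₁ (star c π comp q no-extra)
    ... | inj₂ few = inj₂ (subst (λ N → m * m * N < D * (2 ^ m + m))
      (sym (centred-count π comp q size))
      (gap-universal {m} D (extra G q) (excess G q) (centred-deficiency π comp q D size eq) 6≤m few))

    big-gap : ∀ {U P Q m} → Partition U P Q → Complete G P Q → Cotree G P → Cotree G Q →
      2 ≤ℕ ∣ P ∣ → 2 ≤ℕ ∣ Q ∣ →
      ∀ D → ∣ U ∣ ≡ suc m → 6 ≤ℕ m → (suc m + 1) * N U ≡ 2 * T U + D → Gap U m D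
    big-gap {m = m} π comp p q 2≤P 2≤Q D size 6≤m eq = inj₂ (subst (λ N → m * m * N < D * (2 ^ m + m))
      (sym (trans (count-cotree (join π comp p q)) (cong (_+ extra G (join π comp p q)) size)))
      (gap-join 2≤P 2≤Q 6≤m (trans (sym (∣partition∣ π)) size) D (extra G p) (extra G q) (excess G p) (excess G q)
        (deficiency (join π comp p q) D size eq)))

    data Shape {U : Subset n} : Set where
      single : ∀ c → U ≡ ⁅ c ⁆ → Shape
      plural : 2 ≤ℕ ∣ U ∣ → Shape

    partition≥2 : ∀ {U P Q} → Partition U P Q → Cotree G P → Cotree G Q → 2 ≤ℕ ∣ U ∣
    partition≥2 π p q = subst (2 ≤ℕ_) (sym (∣partition∣ π)) (ℕ.+-mono-≤ (size>0 p) (size>0 q))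

    shape : ∀ {U} → Cotree G U → Shape {U}
    shape (leaf c eq)      = single c eq
    shape (union π _ p q) = plural (partition≥2 π p q)
    shape (join π _ p q)  = plural (partition≥2 π p q)

  join-gap : ∀ {U P Q m} → Partition U P Q → Complete G P Q → Cotree G P → Cotree G Q →
    ∀ D → ∣ U ∣ ≡ suc m → 6 ≤ℕ m → (suc m + 1) * N U ≡ 2 * T U + D →
    Star-centred U ⊎ m * m * N U < D * (2 ^ m + m)
  join-gap π comp p q with shape p | shape q
  ... | single c refl | _             = universal-gap π comp q
  ... | plural _      | single c refl =
    universal-gap (Partition-swap π) (λ x∈ y∈ → adj-sym G (comp y∈ x∈)) p
  ... | plural 2≤P    | plural 2≤Q    = big-gap π comp p q 2≤P 2≤Q

  single-vertex-deficiency : ∀ {U} → Cotree G U → ∀ D → ∣ U ∣ ≡ 1 → 2 * N U ≡ 2 * T U + D → D ≡ 0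
  single-vertex-deficiency t D size eq with shape t
  ... | single c refl = trans (sym (ℕ.+-identityʳ D)) (deficiency (leaf {G = G} c refl) D size eq)
  ... | plural 2≤U    = contradiction (subst (2 ≤ℕ_) size 2≤U) λ { (s≤s ()) }

-- Rational means

open import Data.Integer.Base using (+_; +≤+)
import Data.Integer.Base as ℤ
import Data.Integer.Properties as ℤ
open import Data.Rational.Base using (_/_; _-_; _≤_; toℚᵘ) renaming (_+_ to _+ℚ_; -_ to -ℚ_)
import Data.Rational.Properties as ℚ
import Data.Rational.Unnormalised.Base as ℚᵘ
import Data.Rational.Unnormalised.Properties as ℚᵘ
open import Algebra.Properties.Group ℚ.+-0-group using (∙-cancelˡ)

toℚᵘ-/ : ∀ a b .{{_ : NonZero b}} → toℚᵘ (+ a / b) ℚᵘ.≃ (+ a ℚᵘ./ b)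
toℚᵘ-/ a (suc b) = ℚ.toℚᵘ-fromℚᵘ (ℚᵘ.mkℚᵘ (+ a) b)

private
  cross : ∀ {a b c d} → + a ℤ.* + d ≡ + c ℤ.* + b → a * d ≡ c * b
  cross {a} {b} {c} {d} eq = ℤ.+-injective (trans (ℤ.pos-* a d) (trans eq (sym (ℤ.pos-* c b))))

  cross⁻ : ∀ {a b c d} → a * d ≡ c * b → + a ℤ.* + d ≡ + c ℤ.* + b
  cross⁻ {a} {b} {c} {d} eq = trans (sym (ℤ.pos-* a d)) (trans (cong +_ eq) (ℤ.pos-* c b))

module _ (a b c d : ℕ) .{{_ : NonZero b}} .{{_ : NonZero d}} where

  /-mono-≤ : a * d ≤ℕ c * b → + a / b ≤ + c / d
  /-mono-≤ le = ℚ.toℚᵘ-cancel-≤ (ℚᵘ.≤-respˡ-≃ (ℚᵘ.≃-sym (toℚᵘ-/ a b))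
    (ℚᵘ.≤-respʳ-≃ (ℚᵘ.≃-sym (toℚᵘ-/ c d)) (unnormalised b d le)))
    where
    -- The denominators are quantified anew so that they can be matched as successors, where the
    -- unnormalised fraction computes.
    unnormalised : ∀ b d .{{_ : NonZero b}} .{{_ : NonZero d}} →
                   a * d ≤ℕ c * b → (+ a ℚᵘ./ b) ℚᵘ.≤ (+ c ℚᵘ./ d)
    unnormalised (suc b) (suc d) le =
      ℚᵘ.*≤* (subst₂ ℤ._≤_ (ℤ.pos-* a (suc d)) (ℤ.pos-* c (suc b)) (+≤+ le))

  /-cong-≡ : a * d ≡ c * b → + a / b ≡ + c / d
  /-cong-≡ eq = ℚ.toℚᵘ-injective (ℚᵘ.≃-trans (toℚᵘ-/ a b)
    (ℚᵘ.≃-trans (unnormalised b d eq) (ℚᵘ.≃-sym (toℚᵘ-/ c d))))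
    where
    unnormalised : ∀ b d .{{_ : NonZero b}} .{{_ : NonZero d}} →
                   a * d ≡ c * b → (+ a ℚᵘ./ b) ℚᵘ.≃ (+ c ℚᵘ./ d)
    unnormalised (suc b) (suc d) eq = ℚᵘ.*≡* (cross⁻ {a} {suc b} {c} {suc d} eq)

  /-injective-≡ : + a / b ≡ + c / d → a * d ≡ c * b
  /-injective-≡ eq = unnormalised b d (ℚᵘ.≃-trans (ℚᵘ.≃-sym (toℚᵘ-/ a b))
    (ℚᵘ.≃-trans (ℚ.toℚᵘ-cong eq) (toℚᵘ-/ c d)))
    where
    unnormalised : ∀ b d .{{_ : NonZero b}} .{{_ : NonZero d}} →
                   (+ a ℚᵘ./ b) ℚᵘ.≃ (+ c ℚᵘ./ d) → a * d ≡ c * b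
    unnormalised (suc b) (suc d) (ℚᵘ.*≡* eq) = cross {a} {suc b} {c} {suc d} eq

/-homo-+ : ∀ a b c d .{{_ : NonZero b}} .{{_ : NonZero d}} →
           + a / b +ℚ + c / d ≡ _/_ (+ (a * d + c * b)) (b * d) {{ℕ.m*n≢0 b d}}
/-homo-+ a b@(suc _) c d@(suc _) = ℚ.toℚᵘ-injective (ℚᵘ.≃-trans
  (ℚ.toℚᵘ-homo-+ (+ a / b) (+ c / d))
  (ℚᵘ.≃-trans (ℚᵘ.+-cong (toℚᵘ-/ a b) (toℚᵘ-/ c d))
    (ℚᵘ.≃-trans (ℚᵘ.≃-reflexive (cong (ℚᵘ._/ (b * d))
        (sym (trans (ℤ.pos-+ (a * d) (c * b)) (cong₂ ℤ._+_ (ℤ.pos-* a d) (ℤ.pos-* c b))))))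
      (ℚᵘ.≃-sym (toℚᵘ-/ (a * d + c * b) (b * d))))))

module _ (T N a D : ℕ) .{{_ : NonZero N}} (aN≡2T+D : a * N ≡ 2 * T + D) where

  private
    instance
      2N≢0 = ℕ.m*n≢0 2 N

    -- `T / N + D / (2 * N)` is `(2 * T + D) / (2 * N)`, which is `a / 2`. Comparing the mean with
    -- `a / 2 - y / (2 * k)` thus becomes comparing `D / N` with `y / k`.
    mean≡ : + T / N ≡ + a / 2 - + D / (2 * N)
    mean≡ = begin
      + T / N                                               ≡⟨ ℚ.+-identityʳ (+ T / N) ⟨
      + T / N +ℚ + 0 / 1                                     ≡⟨ cong (λ x → + T / N +ℚ x) (ℚ.+-inverseʳ x) ⟨
      + T / N +ℚ (x - x)                                     ≡⟨ ℚ.+-assoc (+ T / N) x (-ℚ x) ⟨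
      + T / N +ℚ x - x                                       ≡⟨ cong (_- x) sum≡ ⟩
      + a / 2 - x                                           ∎
      where
      open ≡-Reasoning
      x = + D / (2 * N)
      sum≡ : + T / N +ℚ + D / (2 * N) ≡ + a / 2
      sum≡ = trans (/-homo-+ T N D (2 * N)) (/-cong-≡ (T * (2 * N) + D * N) (N * (2 * N)) a 2 {{ℕ.m*n≢0 N (2 * N)}} (begin
        (T * (2 * N) + D * N) * 2   ≡⟨ regroup T D N ⟩
        (2 * T + D) * (2 * N)        ≡⟨ cong (_* (2 * N)) aN≡2T+D ⟨
        a * N * (2 * N)               ≡⟨ ℕ.*-assoc a N (2 * N) ⟩
        a * (N * (2 * N))             ∎))
        where
        regroup : ∀ t d n → (t * (2 * n) + d * n) * 2 ≡ (2 * t + d) * (2 * n)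
        regroup = solve-∀

  module _ (y k : ℕ) .{{_ : NonZero (2 * k)}} where

    private
      double : ∀ x z → x * (2 * z) ≡ 2 * (x * z)
      double = solve-∀

    -- Both bounds of the theorem have this shape: `y = m²`, `k = κ` for the first and `y = 0`,
    -- `k = 1` for the second.
    mean-≤ : y * N ≤ℕ D * k → + T / N ≤ + a / 2 - + y / (2 * k)
    mean-≤ le = subst (_≤ _) (sym mean≡)
      (ℚ.+-monoʳ-≤ (+ a / 2) (ℚ.neg-antimono-≤ (/-mono-≤ y (2 * k) D (2 * N) (subst₂ _≤ℕ_ (sym (double y N)) (sym (double D k))
        (ℕ.*-monoʳ-≤ 2 le)))))

    mean-≡ : + T / N ≡ + a / 2 - + y / (2 * k) ⇔ y * N ≡ D * k
    mean-≡ = mk⇔ to from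
      where
      to : + T / N ≡ + a / 2 - + y / (2 * k) → y * N ≡ D * k
      to eq = ℕ.*-cancelˡ-≡ _ _ 2 (trans (sym (double y N)) (trans (sym (/-injective-≡ D (2 * N) y (2 * k)
        (ℚ.neg-injective (∙-cancelˡ (+ a / 2) _ _ (trans (sym mean≡) eq))))) (double D k)))
      from : y * N ≡ D * k → + T / N ≡ + a / 2 - + y / (2 * k)
      from eq = trans mean≡ (cong (λ x → + a / 2 - x) (/-cong-≡ D (2 * N) y (2 * k)
        (trans (double D k) (trans (cong (2 *_) (sym eq)) (sym (double y N))))))

-- Stars and K 1 m

-- The centre becomes the only vertex of the left part, and `punchOut` at the centre numbers the
-- leaves.
star-centred⇒≅K : ∀ {n} {G : Graph (Fin n)} → Star-centred {G = G} Sub.⊤ → G ≅ K 1 (n ∸ 1)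
star-centred⇒≅K {suc m} {G} (star {Q} c π comp q no-extra) = mk↔ₛ′ to from to∘from from∘to , adj
  where
  to : Fin (suc m) → Fin 1 ⊎ Fin m
  to x with c ≟ x
  ... | yes _   = inj₁ zero
  ... | no  c≢x = inj₂ (punchOut c≢x)

  from : Fin 1 ⊎ Fin m → Fin (suc m)
  from (inj₁ _) = c
  from (inj₂ j) = punchIn c j

  to∘from : ∀ y → to (from y) ≡ y
  to∘from (inj₁ zero) with c ≟ c
  ... | yes _   = refl
  ... | no  c≢c = contradiction refl c≢c
  to∘from (inj₂ j) with c ≟ punchIn c j
  ... | yes eq = contradiction (sym eq) (punchInᵢ≢i c j)
  ... | no  _  = cong inj₂ (trans (punchOut-cong′ c refl) (punchOut-punchIn c))

  from∘to : ∀ x → from (to x) ≡ x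
  from∘to x with c ≟ x
  ... | yes c≡x = c≡x
  ... | no  c≢x = punchIn-punchOut c≢x

  rest : ∀ {x} → c ≢ x → x ∈ Q
  rest {x} c≢x = [ (λ x∈c → contradiction (sym (x∈⁅y⁆⇒x≡y c x∈c)) c≢x) , id ]′ (cover π ∈⊤)

  adj : ∀ u v → Adj G u v ⇔ Adj (K 1 m) (to u) (to v)
  adj u v with c ≟ u | c ≟ v
  ... | yes refl | yes refl = mk⇔ (adj-irrefl G refl) λ ()
  ... | yes refl | no  c≢v  = mk⇔ (λ _ → tt) (λ _ → comp (x∈⁅x⁆ c) (rest c≢v))
  ... | no  c≢u  | yes refl = mk⇔ (λ _ → tt) (λ _ → adj-sym G (comp (x∈⁅x⁆ c) (rest c≢u)))
  ... | no  c≢u  | no  c≢v  = mk⇔ (no-extra⇒anticomplete q no-extra (rest c≢u) (rest c≢v)) λ ()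

module _ {n} {G : Graph (Fin n)} where

  -- `0 < m` provides a leaf, so that the partition has a nonempty second part, and `cograph`
  -- provides the cotree on the leaves that `star` demands.
  ≅K⇒star-centred : ∀ {m} → Cograph G → 0 < m → G ≅ K 1 m → Star-centred {G = G} Sub.⊤
  ≅K⇒star-centred {m} cograph 0<m (f , adj) = star c π comp q (anticomplete⇒no-extra q anti)
    where
    open Inverse f using (to; from; strictlyInverseˡ; strictlyInverseʳ)

    c = from (inj₁ zero)

    to-c : to c ≡ inj₁ zero
    to-c = strictlyInverseˡ (inj₁ zero)

    to-rest : ∀ {x} → x ≢ c → ∃ λ j → to x ≡ inj₂ j
    to-rest {x} x≢c with to x in eq
    ... | inj₁ zero = contradiction (trans (sym (strictlyInverseʳ x)) (cong from eq)) x≢c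
    ... | inj₂ j    = j , refl

    rest? : ∀ x → Dec (x ≢ c)
    rest? x = ¬? (x ≟ c)

    leaf≢c : ∀ j → from (inj₂ j) ≢ c
    leaf≢c j eq with () ← trans (sym (strictlyInverseˡ (inj₂ j))) (trans (cong to eq) to-c)

    some-leaf : ∀ {m} → 0 < m → Fin m
    some-leaf (s≤s _) = zero

    covered : ∀ {x} → x ∈ Sub.⊤ → x ∈ ⁅ c ⁆ ⊎ x ∈ select rest?
    covered {x} _ with x ≟ c
    ... | yes refl = inj₁ (x∈⁅x⁆ c)
    ... | no  x≢c  = inj₂ (∈-select⁺ rest? x≢c)

    π : Partition Sub.⊤ ⁅ c ⁆ (select rest?)
    π = record
      { left = λ _ → ∈⊤ ; right = λ _ → ∈⊤ ; cover = covered
      ; disjoint = λ x∈ x∈′ → ∈-select⁻ rest? x∈′ (x∈⁅y⁆⇒x≡y c x∈)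
      ; leftNonempty = c , x∈⁅x⁆ c
      ; rightNonempty = _ , ∈-select⁺ rest? (leaf≢c (some-leaf 0<m)) }

    comp : Complete G ⁅ c ⁆ (select rest?)
    comp {x} {y} x∈ y∈ with refl ← x∈⁅y⁆⇒x≡y c x∈ | j , eq ← to-rest (∈-select⁻ rest? y∈) =
      Equivalence.from (adj c y) (subst₂ (Adj (K 1 m)) (sym to-c) (sym eq) tt)

    anti : Anticomplete G (select rest?) (select rest?)
    anti {x} {y} x∈ y∈ xy
      with i , eq ← to-rest (∈-select⁻ rest? x∈) | j , eq′ ← to-rest (∈-select⁻ rest? y∈) =
      subst₂ (Adj (K 1 m)) eq eq′ (Equivalence.to (adj x y) xy)

    q : Cotree G (select rest?)
    q = cotree G cograph _ (⊂-wellFounded _) (rightNonempty π)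

  -- The two bounds for connected cographs

  ⊤-not-separated : ∀ {P Q} → Connected G → Partition Sub.⊤ P Q → ¬ Anticomplete G P Q
  ⊤-not-separated (_ , walk) π anti =
    let p , p∈P = leftNonempty π; q , q∈Q = rightNonempty π in
    disjoint π (stays-left G π anti ⊆⊤ (within-⊤ (walk p q)) p∈P) q∈Q
    where
    within-⊤ : ∀ {x y} → Star (Adj G) x y → Star (Adj (induced G (_∈ Sub.⊤))) (x , ∈⊤) (y , ∈⊤)
    within-⊤ ε        = ε
    within-⊤ (e ◅ es) = e ◅ within-⊤ es

  -- The root of the cotree must be a join: a leaf contradicts `6 ≤ m`, and a union contradicts
  -- connectedness.
  connected-gap : ∀ {m} → n ≡ suc m → Connected G → (t : Cotree G Sub.⊤) → 6 ≤ℕ m → ∀ D →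
    (suc m + 1) * total (within G Sub.⊤) one ≡ 2 * total (within G Sub.⊤) id + D →
    Star-centred {G = G} Sub.⊤ ⊎ m * m * total (within G Sub.⊤) one < D * (2 ^ m + m)
  connected-gap size con (leaf v ⊤≡v) 6≤m D _ =
    contradiction (trans (sym (trans (∣⊤∣≡n n) size)) (trans (cong ∣_∣ ⊤≡v) (∣⁅x⁆∣≡1 v)))
                  (λ { refl → ℕ.n≮0 6≤m })
  connected-gap _ con (union π anti _ _) _ _ _ =
    contradiction (λ {x} {y} → anti {x} {y}) (⊤-not-separated con π)
  connected-gap size con (join π comp p q) 6≤m D eq =
    join-gap π comp p q D (trans (∣⊤∣≡n n) size) 6≤m eq

-- n is not matched as a successor, since Φ G would then unfold.
module _ (n : ℕ) .{{_ : NonZero n}} (G : Graph (Fin n)) (con : Connected G) (cograph : Cograph G) where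

  private
    m = n ∸ 1

    n≡1+m : n ≡ suc m
    n≡1+m = sym (ℕ.suc-pred n)

    size⊤ : ∣ Sub.⊤ {n} ∣ ≡ suc m
    size⊤ = trans (∣⊤∣≡n n) n≡1+m

    N = eval (Φ G) 1
    T = eval (deriv (Φ G)) 1

    6≤m : 7 ≤ℕ n → 6 ≤ℕ m
    6≤m = ℕ.pred-mono-≤

    instance
      N≢0 = eval-Φ≢0 G

    t : Cotree G Sub.⊤
    t = cotree G cograph Sub.⊤ (⊂-wellFounded _) (proj₁ con , ∈⊤)

    Deficiency : ℕ → Set
    Deficiency D = (n + 1) * N ≡ 2 * T + D

    to-totals : ∀ {D} → Deficiency D →
      (suc m + 1) * total (within G Sub.⊤) one ≡ 2 * total (within G Sub.⊤) id + D
    to-totals {D} = subst₂ (λ N T → (suc m + 1) * N ≡ 2 * T + D) (eval-Φ G) (eval-deriv-Φ G)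
      ∘ subst (λ k → (k + 1) * N ≡ 2 * T + D) n≡1+m

    ∃D : ∃ λ D → Deficiency D × m * m ≤ℕ D
    ∃D with D , eq , m²≤D ← ∃deficiency t size⊤ =
      D , subst (λ k → (k + 1) * N ≡ 2 * T + D) (sym n≡1+m)
            (subst₂ (λ N T → (suc m + 1) * N ≡ 2 * T + D)
                    (sym (eval-Φ G)) (sym (eval-deriv-Φ G)) eq) , m²≤D

    half-bound′ : ∀ D → Deficiency D → m * m ≤ℕ D →
                  M G ≤ + (n + 1) / 2 × (M G ≡ + (n + 1) / 2 ⇔ n ≡ 1)
    half-bound′ D eq m²≤D =
      -- With `y = 0` and `k = 1` the subtracted fraction computes to zero. Equality then says
      -- `D = 0`, and `m * m ≤ D` forces `m = 0`.
      subst (λ x → M G ≤ x × (M G ≡ x ⇔ n ≡ 1)) (ℚ.+-identityʳ (+ (n + 1) / 2))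
        (mean-≤ T N (n + 1) D eq 0 1 z≤n , mk⇔ (only ∘ Equivalence.to (mean-≡ T N (n + 1) D eq 0 1))
                                 (Equivalence.from (mean-≡ T N (n + 1) D eq 0 1) ∘ attained))
      where
      m*m≡0⇒m≡0 : ∀ k → k * k ≡ 0 → k ≡ 0
      m*m≡0⇒m≡0 zero _ = refl

      only : 0 ≡ D * 1 → n ≡ 1
      only D≡0 = trans n≡1+m (cong suc (m*m≡0⇒m≡0 m (ℕ.n≤0⇒n≡0
        (subst (m * m ≤ℕ_) (trans (sym (ℕ.*-identityʳ D)) (sym D≡0)) m²≤D))))

      attained : n ≡ 1 → 0 ≡ D * 1
      attained n≡1 = sym (trans (ℕ.*-identityʳ D)
        (single-vertex-deficiency t D (trans (∣⊤∣≡n n) n≡1)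
          (subst (λ k → (k + 1) * total (within G Sub.⊤) one ≡ 2 * total (within G Sub.⊤) id + D)
                 (trans (sym n≡1+m) n≡1) (to-totals eq))))

    Gap : ℕ → Set
    Gap D = Star-centred {G = G} Sub.⊤ ⊎ m * m * total (within G Sub.⊤) one < D * (2 ^ m + m)

    star-bound′ : ∀ D → Deficiency D → Gap D → 7 ≤ℕ n →
      let bound = + (n + 1) / 2 - _/_ (+ (m ^ 2)) (2 * (2 ^ m + m)) {{denominator≢0 n}}
      in M G ≤ bound × (M G ≡ bound ⇔ G ≅ K 1 m)
    star-bound′ D eq gap 7≤n = mean-≤ T N (n + 1) D eq (m ^ 2) κ (≤-gap gap) ,
      mk⇔ (only gap ∘ Equivalence.to (mean-≡ T N (n + 1) D eq (m ^ 2) κ))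
          (Equivalence.from (mean-≡ T N (n + 1) D eq (m ^ 2) κ) ∘ attained
            ∘ ≅K⇒star-centred cograph (ℕ.≤-trans (s≤s z≤n) (6≤m 7≤n)))
      where
      κ = 2 ^ m + m
      instance
        2κ≢0 = denominator≢0 n

      lhs≡ : m * m * total (within G Sub.⊤) one ≡ m ^ 2 * N
      lhs≡ = cong₂ _*_ (cong (m *_) (sym (ℕ.*-identityʳ m))) (sym (eval-Φ G))

      attained : Star-centred {G = G} Sub.⊤ → m ^ 2 * N ≡ D * κ
      attained s = trans (sym lhs≡) (star-gap D s size⊤ (to-totals eq))

      ≤-gap : Gap D → m ^ 2 * N ≤ℕ D * κ
      ≤-gap (inj₁ s)  = ℕ.≤-reflexive (attained s)
      ≤-gap (inj₂ lt) = subst (_≤ℕ D * κ) lhs≡ (ℕ.<⇒≤ lt)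

      only : Gap D → m ^ 2 * N ≡ D * κ → G ≅ K 1 m
      only (inj₁ s)  _     = star-centred⇒≅K s
      only (inj₂ lt) tight = contradiction (trans lhs≡ tight) (ℕ.<⇒≢ lt)

  half-bound : M G ≤ + (n + 1) / 2 × (M G ≡ + (n + 1) / 2 ⇔ n ≡ 1)
  half-bound = let D , eq , m²≤D = ∃D in half-bound′ D eq m²≤D

  star-bound : 7 ≤ℕ n →
    let bound = + (n + 1) / 2 - _/_ (+ (m ^ 2)) (2 * (2 ^ m + m)) {{denominator≢0 n}}
    in M G ≤ bound × (M G ≡ bound ⇔ G ≅ K 1 m)
  star-bound 7≤n = let D , eq , _ = ∃D in
    star-bound′ D eq (connected-gap n≡1+m con t (6≤m 7≤n) D (to-totals eq)) 7≤n

corollary2p7 :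
  (∀ n .{{_ : NonZero n}} (G : Graph (Fin n)) → Connected G → Cograph G → 7 ≤ℕ n →
     let bound = + (n + 1) / 2
                 - _/_ (+ ((n ∸ 1) ^ 2)) (2 * (2 ^ (n ∸ 1) + (n ∸ 1))) {{denominator≢0 n}}
     in M G ≤ bound × (M G ≡ bound ⇔ G ≅ K 1 (n ∸ 1)))
  × (∀ n .{{_ : NonZero n}} (G : Graph (Fin n)) → Connected G → Cograph G →
     M G ≤ + (n + 1) / 2 × (M G ≡ + (n + 1) / 2 ⇔ n ≡ 1))
corollary2p7 = (λ n G con cograph 7≤n → star-bound n G con cograph 7≤n)
             , (λ n G con cograph → half-bound n G con cograph)
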